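{- Let $E: y^2+xy=x^3+x^2-2x$ and $E': y^2+xy=x^3+x^2+8x+10$ be elliptic curves over $\mathbb{Q}$, let $P=(2,2)\in E(\mathbb{Q})$ and $R=(1,4)\in E'(\mathbb{Q})$. Let $(a_m)_{m\ge0}$ be the Somos-5 sequence ($a_0=\dots=a_4=1$, $a_m=(a_{m-1}a_{m-4}+a_{m-2}a_{m-3})/a_{m-5}$ for $m\ge5$). Let $p$ be a prime with $p\notin\{2,3,17\}$. If $p$ divides some term $a_m$, then the order of (the reduction of) $P$ in $E(\mathbb{F}_p)$ is twice the order of (the reduction of) $R$ in $E'(\mathbb{F}_p)$. Otherwise, the order of $P$ in $E(\mathbb{F}_p)$ equals the order of $R$ in $E'(\mathbb{F}_p)$.
   Context: $E$ and $E'$ have good reduction at every prime $p\notin\{2,3,17\}$ ($E$ has conductor $102$). There is a $2$-isogeny $\phi:E\to E'$, $\phi(x,y)=\left(\frac{x^2-2}{x},\frac{x^2y+2x+2y}{x^2}\right)$, with kernel $\{O,(0,0)\}$ and $\phi(P)=R$. -}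

module Defs where

open import Data.Nat as ℕ using (ℕ; zero; suc; _∸_; _≤_; _<_)
open import Data.Nat.Divisibility using (_∣_)
open import Data.Integer as ℤ using (ℤ; +_; -_; _%ℕ_)
open import Data.Bool using (Bool; true; false; if_then_else_; _∧_)
open import Data.Product using (_×_; _,_)
open import Relation.Nullary.Decidable using (⌊_⌋)
open import Relation.Binary.PropositionalEquality using (_≡_; _≢_)

-- Arithmetic in ℤ/pℤ, elements represented by canonical ℤ in [0, p).

red : ℕ → ℤ → ℤ
red zero    z = z
red (suc k) z = + (z %ℕ suc k)

module Fp (p : ℕ) where
  infixl 6 _+'_ _-'_
  infixl 7 _*'_

  _+'_ _-'_ _*'_ : ℤ → ℤ → ℤ
  a +' b = red p (a ℤ.+ b)
  a -' b = red p (a ℤ.- b)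
  a *' b = red p (a ℤ.* b)

  c : ℤ → ℤ
  c z = red p z

  pow : ℤ → ℕ → ℤ
  pow a zero    = c (+ 1)
  pow a (suc k) = a *' pow a k

  -- multiplicative inverse in F_p (p prime), via Fermat: a⁻¹ = a^(p-2)
  inv : ℤ → ℤ
  inv a = pow (c a) (p ∸ 2)

  _/'_ : ℤ → ℤ → ℤ
  a /' b = a *' inv b

  eq? : ℤ → ℤ → Bool
  eq? a b = ⌊ c a ℤ.≟ c b ⌋

-- Points of a Weierstrass curve y² + a₁xy + a₃y = x³ + a₂x² + a₄x + a₆
-- over F_p: the point at infinity O, or an affine point (x , y) with
-- canonical coordinates.

data Point : Set where
  O   : Point
  aff : ℤ → ℤ → Point

record Weierstrass : Set where
  constructor W
  field a₁ a₂ a₃ a₄ a₆ : ℤ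

-- Standard chord-and-tangent addition law (Silverman, III.2.3)
add : Weierstrass → ℕ → Point → Point → Point
add E p O Q = Q
add E p P O = P
add E p (aff x₁ y₁) (aff x₂ y₂) =
  if eq? x₁ x₂ ∧ eq? (y₁ +' y₂ +' a₁ *' x₂ +' a₃) (+ 0)
  then O
  else aff x₃ y₃
  where
  open Weierstrass E
  open Fp p
  λ' : ℤ
  λ' = if eq? x₁ x₂
       then (c (+ 3) *' x₁ *' x₁ +' c (+ 2) *' a₂ *' x₁ +' a₄ -' a₁ *' y₁)
              /' (c (+ 2) *' y₁ +' a₁ *' x₁ +' a₃)
       else (y₂ -' y₁) /' (x₂ -' x₁)
  x₃ : ℤ
  x₃ = λ' *' λ' +' a₁ *' λ' -' a₂ -' x₁ -' x₂
  y₃ : ℤ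
  y₃ = c (+ 0) -' (λ' +' a₁) *' x₃ -' (y₁ -' λ' *' x₁) -' a₃

smul : Weierstrass → ℕ → ℕ → Point → Point
smul E p zero    P = O
smul E p (suc n) P = add E p P (smul E p n P)

IsOrder : Weierstrass → ℕ → Point → ℕ → Set
IsOrder E p P n =
  1 ≤ n × smul E p n P ≡ O × (∀ k → 1 ≤ k → k < n → smul E p k P ≢ O)

reduce : ℕ → ℤ → ℤ → Point
reduce p x y = aff (red p x) (red p y)

Ecurve : Weierstrass
Ecurve = W (+ 1) (+ 1) (+ 0) (- (+ 2)) (+ 0)

E'curve : Weierstrass
E'curve = W (+ 1) (+ 1) (+ 0) (+ 8) (+ 10)

Pmod : ℕ → Point
Pmod p = reduce p (+ 2) (+ 2)

Rmod : ℕ → Point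
Rmod p = reduce p (+ 1) (+ 4)

-- Somos-5 sequence. The division in the recurrence is exact (the terms
-- are positive integers), so it is computed with ℕ division; the
-- divisor is never 0, the zero-branch is only there for totality.

divℕ : ℕ → ℕ → ℕ
divℕ n zero    = 0
divℕ n (suc k) = n ℕ./ suc k

somos5-window : ℕ → ℕ × ℕ × ℕ × ℕ × ℕ
somos5-window zero = 1 , 1 , 1 , 1 , 1
somos5-window (suc m) with somos5-window m
... | (a , b , c , d , e) = b , c , d , e , divℕ (e ℕ.* b ℕ.+ d ℕ.* c) a

somos5 : ℕ → ℕ
somos5 m with somos5-window m
... | (a , _) = a

DividesSomos5 : ℕ → Set
DividesSomos5 p = Data.Product.∃ λ m → p ∣ somos5 m

{-# OPTIONS --safe #-}
module Submission where

open import Defs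
open import Data.Nat.Base as ℕ using (ℕ; zero; suc; s≤s; z≤n; _∸_; NonZero)
import Data.Nat.Properties as ℕ
open import Data.Nat.Combinatorics using (_C_; nCk≡n!/k![n-k]!; k![n∸k]!∣n!; nCn≡1)
open import Data.Nat.DivMod using (m/n*n≡m; _/_; _%_; m%n<n; m≡m%n+[m/n]*n)
import Data.Nat.Divisibility as ℕᵈ
import Data.Nat.Coprimality as Coprimality
import Data.Nat.Tactic.RingSolver as ℕ-Solver
open import Data.Nat.Primality using (Prime; euclidsLemma; prime⇒nonZero; prime⇒nonTrivial)
open import Data.Integer.Base as ℤ using (ℤ; +_)
import Data.Integer.Properties as ℤ
open import Data.Integer.DivMod using (a≡a%ℕn+[a/ℕn]*n; n%ℕd<d)
import Data.Integer.Divisibility.Signed as ℤᵈ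
open import Data.Integer.Tactic.RingSolver using (solve; solve-∀)
open import Data.Fin.Base as Fin using (Fin; zero; suc; toℕ; inject₁; fromℕ)
import Data.Fin.Properties as Fin
open import Data.List.Base using (_∷_; [])
open import Data.Sum.Base as Sum using (_⊎_; inj₁; inj₂)
open import Data.Product using (Σ; ∃; _×_; _,_; proj₁; proj₂)
open import Data.Bool.Base using (true; false; if_then_else_; _∧_)
open import Data.Empty using (⊥-elim)
open import Function.Base using (_∘_)
open import Relation.Nullary using (¬_; Dec; yes; no; contradiction)
open import Relation.Nullary.Decidable using (map′; _×-dec_)
open import Relation.Binary.PropositionalEquality
import Algebra.Properties.CommutativeSemiring.Binomial ℕ.+-*-commutativeSemiring as Binomial
import Algebra.Properties.Semiring.Exp ℕ.+-*-semiring as Exp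
import Algebra.Properties.Semiring.Mult ℕ.+-*-semiring as Mult
open import Algebra.Properties.Semiring.Sum ℕ.+-*-semiring using (sum; sum-init-last)

-- Write T = (0, 0), so that ker φ = {O, T}.  Translation by P and negation ν
-- satisfy P + ν (P + X) = ν X, which makes translation injective on E(𝔽_p) and
-- lets every path along the translates of P be run backwards.  Hence, since
-- ν O = O and ν T = T, if m is least with mP = T then P has order 2m, while
-- kR = φ(kP) vanishes exactly when kP is O or T.  Finally T is a multiple of P
-- if and only if the orbit T, P + T, 2P + T, … meets O; its point mP + T is
-- a rational expression in the Somos-5 terms of index m, …, m + 4, which first
-- degenerates where p divides a term.

-- `add` is a bare formula, so everything is phrased through translation by the fixed points P and
-- R. Substituting x = 2 + t, y = 2 + l t into the equation of E and dividing by t leaves a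
-- quadratic in t with root sum l² + l - 7 and product 12 - 6l; translation by P replaces t by the
-- other root and then negates. Every identity thus becomes polynomial. Compatibility with φ is the
-- laborious step. For X outside {O, T}, each coordinate of φX is the sum of those of X and X + T,
-- which is why the lines from P to X and to X + T control the line from R to φX. The primes 2 and 3
-- are inverted in the tangents, whose denominators 2y + x are 6 at P and 9 at R. The two cases are
-- not separated by deciding `DividesSomos5`, an unbounded existence statement, but by a search for
-- T among the multiples kP with k below the order of P. On the Somos side, translation by P is (w,
-- v) ↦ (v, u) on the cubic `Level`, with w and u the two roots for the given v; if a_k is the first
-- term divisible by p, then (k - 2)P + T = O.

-- Canonical representatives modulo p.

module Residue where
  open import Data.Integer.Base using (_+_; _*_; _-_; -_)

  ∣red- : ∀ q a → + q ℤᵈ.∣ red q a - a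
  ∣red- zero    a = ℤᵈ.divides (+ 0) (ℤ.+-inverseʳ a)
  ∣red- (suc q) a = ℤᵈ.divides (- (a ℤ./ℕ suc q))
    (trans (cong (λ z → r - z) (a≡a%ℕn+[a/ℕn]*n a (suc q))) (lemma r (a ℤ./ℕ suc q) (+ suc q)))
    where
    r : ℤ
    r = + (a ℤ.%ℕ suc q)
    lemma : ∀ r b q → r - (r + b * q) ≡ - b * q
    lemma = solve-∀

  ∣∸⇒≡ : ∀ {q m n} → m ℕ.< q → n ℕ.≤ m → q ℕᵈ.∣ (m ∸ n) → m ≡ n
  ∣∸⇒≡ {q} {m} {n} m<q n≤m d with m ∸ n in eq
  ... | zero  = ℕ.≤-antisym (ℕ.m∸n≡0⇒m≤n eq) n≤m
  ... | suc k = contradiction (ℕᵈ.∣⇒≤ d)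
                  (ℕ.<⇒≱ (ℕ.≤-<-trans (subst (ℕ._≤ m) eq (ℕ.m∸n≤m m n)) m<q))

  ∣-⇒≡ : ∀ {q m n} → m ℕ.< q → n ℕ.< q → + q ℤᵈ.∣ + m - + n → m ≡ n
  ∣-⇒≡ {q} {m} {n} m<q n<q d with ℕ.≤-total n m
  ... | inj₁ n≤m = ∣∸⇒≡ m<q n≤m
    (subst (λ z → q ℕᵈ.∣ ℤ.∣ z ∣) (trans (ℤ.m-n≡m⊖n m n) (ℤ.⊖-≥ n≤m)) (ℤᵈ.∣⇒∣ᵤ d))
  ... | inj₂ m≤n = sym (∣∸⇒≡ n<q m≤n
    (subst (q ℕᵈ.∣_) (trans (ℤ.∣i-j∣≡∣j-i∣ (+ m) (+ n))
      (cong ℤ.∣_∣ (trans (ℤ.m-n≡m⊖n n m) (ℤ.⊖-≥ m≤n)))) (ℤᵈ.∣⇒∣ᵤ d)))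

  red-unique : ∀ q a b → + q ℤᵈ.∣ red q a - red q b → red q a ≡ red q b
  red-unique zero    a b d = ℤ.i-j≡0⇒i≡j a b (ℤᵈ.0∣⇒≡0 d)
  red-unique (suc q) a b d = cong +_ (∣-⇒≡ (n%ℕd<d a (suc q)) (n%ℕd<d b (suc q)) d)

-- Congruence modulo p.

module Congruence (p : ℕ) where
  open import Data.Integer.Base using (_+_; _*_; _-_; -_)
  open Residue

  infix 4 _≋_ _≋?_
  infixl 6 _⟨+⟩_ _⟨-⟩_
  infixl 7 _⟨*⟩_

  record _≋_ (a b : ℤ) : Set where
    constructor mod
    field divides : + p ℤᵈ.∣ a - b
  open _≋_ public

  abstract
    _≋?_ : ∀ a b → Dec (a ≋ b)
    a ≋? b = map′ mod divides (+ p ℤᵈ.∣? a - b)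

  -- Certificates of ideal membership: the caller writes the difference of the two sides as an
  -- explicit combination of differences already known to vanish, and the ring solver checks the
  -- identity over ℤ. Nearly all algebra below has this form, up to `lin₄`.
  lin₁ : ∀ {a b a₁ b₁} c₁ → a₁ ≋ b₁ → a - b ≡ c₁ * (a₁ - b₁) → a ≋ b
  lin₁ c₁ h₁ eq = mod (subst (+ p ℤᵈ.∣_) (sym eq) (ℤᵈ.∣n⇒∣m*n c₁ (divides h₁)))

  lin₂ : ∀ {a b a₁ b₁ a₂ b₂} c₁ → a₁ ≋ b₁ → ∀ c₂ → a₂ ≋ b₂ →
         a - b ≡ c₁ * (a₁ - b₁) + c₂ * (a₂ - b₂) → a ≋ b
  lin₂ c₁ h₁ c₂ h₂ eq = mod (subst (+ p ℤᵈ.∣_) (sym eq)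
    (ℤᵈ.∣m∣n⇒∣m+n (ℤᵈ.∣n⇒∣m*n c₁ (divides h₁)) (ℤᵈ.∣n⇒∣m*n c₂ (divides h₂))))

  lin₃ : ∀ {a b a₁ b₁ a₂ b₂ a₃ b₃} c₁ → a₁ ≋ b₁ → ∀ c₂ → a₂ ≋ b₂ → ∀ c₃ → a₃ ≋ b₃ →
         a - b ≡ c₁ * (a₁ - b₁) + c₂ * (a₂ - b₂) + c₃ * (a₃ - b₃) → a ≋ b
  lin₃ c₁ h₁ c₂ h₂ c₃ h₃ eq = mod (subst (+ p ℤᵈ.∣_) (sym eq)
    (ℤᵈ.∣m∣n⇒∣m+n (ℤᵈ.∣m∣n⇒∣m+n (ℤᵈ.∣n⇒∣m*n c₁ (divides h₁)) (ℤᵈ.∣n⇒∣m*n c₂ (divides h₂)))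
      (ℤᵈ.∣n⇒∣m*n c₃ (divides h₃))))

  lin₄ : ∀ {a b a₁ b₁ a₂ b₂ a₃ b₃ a₄ b₄} c₁ → a₁ ≋ b₁ → ∀ c₂ → a₂ ≋ b₂ → ∀ c₃ → a₃ ≋ b₃ → ∀ c₄ → a₄ ≋ b₄ →
         a - b ≡ c₁ * (a₁ - b₁) + c₂ * (a₂ - b₂) + c₃ * (a₃ - b₃) + c₄ * (a₄ - b₄) → a ≋ b
  lin₄ c₁ h₁ c₂ h₂ c₃ h₃ c₄ h₄ eq = mod (subst (+ p ℤᵈ.∣_) (sym eq)
    (ℤᵈ.∣m∣n⇒∣m+n (ℤᵈ.∣m∣n⇒∣m+n (ℤᵈ.∣m∣n⇒∣m+n (ℤᵈ.∣n⇒∣m*n c₁ (divides h₁)) (ℤᵈ.∣n⇒∣m*n c₂ (divides h₂)))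
      (ℤᵈ.∣n⇒∣m*n c₃ (divides h₃))) (ℤᵈ.∣n⇒∣m*n c₄ (divides h₄))))

  ≋-reflexive : ∀ {a b} → a ≡ b → a ≋ b
  ≋-reflexive {a} refl = mod (ℤᵈ.divides (+ 0) (ℤ.+-inverseʳ a))

  ≋-refl : ∀ {a} → a ≋ a
  ≋-refl = ≋-reflexive refl

  ≋-sym : ∀ {a b} → a ≋ b → b ≋ a
  ≋-sym {a} {b} h = lin₁ (- (+ 1)) h (solve (a ∷ b ∷ []))

  ≋-trans : ∀ {a b c} → a ≋ b → b ≋ c → a ≋ c
  ≋-trans {a} {b} {c} h k = lin₂ (+ 1) h (+ 1) k (solve (a ∷ b ∷ c ∷ []))

  _⟨+⟩_ : ∀ {a b c d} → a ≋ b → c ≋ d → a + c ≋ b + d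
  _⟨+⟩_ {a} {b} {c} {d} h k = lin₂ (+ 1) h (+ 1) k (solve (a ∷ b ∷ c ∷ d ∷ []))

  _⟨-⟩_ : ∀ {a b c d} → a ≋ b → c ≋ d → a - c ≋ b - d
  _⟨-⟩_ {a} {b} {c} {d} h k = lin₂ (+ 1) h (- (+ 1)) k (solve (a ∷ b ∷ c ∷ d ∷ []))

  _⟨*⟩_ : ∀ {a b c d} → a ≋ b → c ≋ d → a * c ≋ b * d
  _⟨*⟩_ {a} {b} {c} {d} h k = lin₂ c h b k (solve (a ∷ b ∷ c ∷ d ∷ []))

  ≋0⇒∣ : ∀ {a} → a ≋ + 0 → p ℕᵈ.∣ ℤ.∣ a ∣
  ≋0⇒∣ {a} h = subst (λ z → p ℕᵈ.∣ ℤ.∣ z ∣) (ℤ.+-identityʳ a) (ℤᵈ.∣⇒∣ᵤ (divides h))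

  ∣⇒≋0 : ∀ {a} → p ℕᵈ.∣ ℤ.∣ a ∣ → a ≋ + 0
  ∣⇒≋0 {a} d = mod (subst (+ p ℤᵈ.∣_) (sym (ℤ.+-identityʳ a)) (ℤᵈ.∣ᵤ⇒∣ d))

  red-≋ : ∀ a → red p a ≋ a
  red-≋ a = mod (∣red- p a)

  red-injective : ∀ {a b} → red p a ≡ red p b → a ≋ b
  red-injective {a} {b} eq =
    ≋-trans (≋-sym (red-≋ a)) (≋-trans (≋-reflexive eq) (red-≋ b))

  red-cong : ∀ {a b} → a ≋ b → red p a ≡ red p b
  red-cong {a} {b} h = red-unique p a b
    (divides (≋-trans (red-≋ a) (≋-trans h (≋-sym (red-≋ b)))))

-- Fermat's little theorem.

module Fermat {p : ℕ} (prime : Prime p) where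
  open import Data.Nat.Base using (_+_; _*_; _^_; _<_; _≤_)
  open import Data.Nat.Divisibility using (_∣_)
  open Congruence p
  p∣k!⇒p≤k : ∀ k → p ∣ k ℕ.! → p ≤ k
  p∣k!⇒p≤k zero p∣1 = contradiction (ℕᵈ.∣1⇒≡1 p∣1) (ℕ.nonTrivial⇒≢1 {{prime⇒nonTrivial prime}})
  p∣k!⇒p≤k (suc k) d with euclidsLemma (suc k) (k ℕ.!) prime d
  ... | inj₁ e = ℕᵈ.∣⇒≤ e
  ... | inj₂ e = ℕ.m≤n⇒m≤1+n (p∣k!⇒p≤k k e)

  p∣p! : p ∣ p ℕ.!
  p∣p! = go p {{prime⇒nonZero prime}}
    where
    go : ∀ n → .{{NonZero n}} → n ∣ n ℕ.!
    go (suc n) = ℕᵈ.m∣m*n (n ℕ.!)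

  -- The prime p divides p! = (p C k) · k! · (p - k)! but neither of the two factorials, whose
  -- arguments are below p.
  p∣pCk : ∀ {k} → 0 < k → k < p → p ∣ p C k
  p∣pCk {k} 0<k k<p with euclidsLemma (p C k) (k ℕ.! * (p ∸ k) ℕ.!) prime (subst (p ∣_) (sym eq) p∣p!)
    where
    eq : (p C k) * (k ℕ.! * (p ∸ k) ℕ.!) ≡ p ℕ.!
    eq = trans (cong (_* (k ℕ.! * (p ∸ k) ℕ.!)) (nCk≡n!/k![n-k]! (ℕ.<⇒≤ k<p)))
               (m/n*n≡m {{_}} (k![n∸k]!∣n! (ℕ.<⇒≤ k<p)))
  ... | inj₁ d = d
  ... | inj₂ d with euclidsLemma (k ℕ.!) ((p ∸ k) ℕ.!) prime d
  ...   | inj₁ e = contradiction (p∣k!⇒p≤k k e) (ℕ.<⇒≱ k<p)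
  ...   | inj₂ e = contradiction (p∣k!⇒p≤k (p ∸ k) e) (ℕ.<⇒≱ (ℕ.∸-monoʳ-< 0<k (ℕ.<⇒≤ k<p)))

  ^-agree : ∀ x n → x Exp.^ n ≡ x ^ n
  ^-agree x zero    = refl
  ^-agree x (suc n) = cong (x *_) (^-agree x n)

  ×-agree : ∀ n x → n Mult.× x ≡ n * x
  ×-agree zero    x = refl
  ×-agree (suc n) x = cong (λ z → x + z) (×-agree n x)

  1^ : ∀ n → 1 Exp.^ n ≡ 1
  1^ n = trans (^-agree 1 n) (ℕ.^-zeroˡ n)

  ∣-sum : ∀ {n} (f : Fin n → ℕ) → (∀ i → p ∣ f i) → p ∣ sum f
  ∣-sum {zero}  f h = p ℕᵈ.∣0
  ∣-sum {suc n} f h = ℕᵈ.∣m∣n⇒∣m+n (h zero) (∣-sum (f ∘ suc) (h ∘ suc))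

  freshman : ∀ x → ∃ λ d → p ∣ d × (x + 1) ^ p ≡ 1 + d + x ^ p
  freshman x = go p refl
    where
    open ≡-Reasoning
    go : ∀ n → n ≡ p → ∃ λ d → p ∣ d × (x + 1) ^ n ≡ 1 + d + x ^ n
    go zero    eq = contradiction (sym eq) (ℕ.≢-nonZero⁻¹ p {{prime⇒nonZero prime}})
    go (suc n) eq = sum middle , ∣-sum middle p∣middle , (begin
      (x + 1) ^ suc n                    ≡⟨ ^-agree (x + 1) (suc n) ⟨
      (x + 1) Exp.^ suc n                ≡⟨ Binomial.theorem (suc n) x 1 ⟩
      sum term                           ≡⟨ sum-init-last term ⟩
      term zero + sum middle + term last ≡⟨ cong₂ _+_ (cong (_+ sum middle) first≡) last≡ ⟩
      1 + sum middle + x ^ suc n         ∎)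
      where
      term : Fin (suc (suc n)) → ℕ
      term = Binomial.binomialTerm x 1 (suc n)
      last : Fin (suc (suc n))
      last = fromℕ (suc n)
      middle : Fin n → ℕ
      middle i = term (suc (inject₁ i))
      first≡ : term zero ≡ 1
      first≡ = trans (×-agree 1 (1 * 1 Exp.^ suc n))
                     (trans (ℕ.*-identityˡ _) (trans (ℕ.*-identityˡ _) (1^ (suc n))))
      last≡ : term last ≡ x ^ suc n
      last≡ rewrite Fin.toℕ-fromℕ n | nCn≡1 (suc n) | ℕ.n∸n≡0 n =
        trans (ℕ.+-identityʳ _) (trans (ℕ.*-identityʳ _) (^-agree x (suc n)))
      p∣middle : ∀ i → p ∣ middle i
      p∣middle i = subst (p ∣_) (sym (×-agree (suc n C toℕ j) (Binomial.binomial x 1 (suc n) j)))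
        (ℕᵈ.∣m⇒∣m*n _ (subst (λ m → p ∣ (m C toℕ j)) (sym eq)
          (p∣pCk (s≤s z≤n) (subst (toℕ j <_) eq (s≤s (subst (_< n) (sym (Fin.toℕ-inject₁ i)) (Fin.toℕ<n i)))))))
        where
        j : Fin (suc (suc n))
        j = suc (inject₁ i)

  little : ∀ x → + (x ^ p) ≋ + x
  little zero    = ≋-reflexive (cong +_ (0^ p {{prime⇒nonZero prime}}))
    where
    0^ : ∀ n → .{{NonZero n}} → 0 ^ n ≡ 0
    0^ (suc n) = refl
  little (suc x) with freshman x
  ... | d , p∣d , eq = ≋-trans (≋-reflexive (cong +_ (trans (cong (_^ p) (ℕ.+-comm 1 x)) eq)))
    (lin₂ (+ 1) (little x) (+ 1) (∣⇒≋0 {+ d} p∣d) (lemma (+ d) (+ (x ^ p)) (+ x)))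
    where
    lemma : ∀ d y x → (+ 1 ℤ.+ d ℤ.+ y) ℤ.- (+ 1 ℤ.+ x) ≡ + 1 ℤ.* (y ℤ.- x) ℤ.+ + 1 ℤ.* (d ℤ.- + 0)
    lemma = solve-∀

-- The field of p elements and the addition law over it.

module PrimeField {p : ℕ} (prime : Prime p) where
  open import Data.Integer.Base using (_+_; _*_; _-_; -_)
  open Congruence p public
  open Fp p

  infix 4 _≉_
  _≉_ : ℤ → ℤ → Set
  a ≉ b = ¬ a ≋ b

  abstract
    zero-product : ∀ {a b} → a * b ≋ + 0 → a ≋ + 0 ⊎ b ≋ + 0
    zero-product {a} {b} h
      with euclidsLemma ℤ.∣ a ∣ ℤ.∣ b ∣ prime (subst (p ℕᵈ.∣_) (ℤ.abs-* a b) (≋0⇒∣ h))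
    ... | inj₁ d = inj₁ (∣⇒≋0 d)
    ... | inj₂ d = inj₂ (∣⇒≋0 d)

  cancel : ∀ {a b c} → c ≉ + 0 → c * a ≋ c * b → a ≋ b
  cancel {a} {b} {c} c≉0 h
    with zero-product {c} {a - b} (lin₁ (+ 1) h (solve (a ∷ b ∷ c ∷ [])))
  ... | inj₁ c≋0 = contradiction c≋0 c≉0
  ... | inj₂ e   = lin₁ (+ 1) e (solve (a ∷ b ∷ []))

  1≉0 : + 1 ≉ + 0
  1≉0 h = ℕ.nonTrivial⇒≢1 {{prime⇒nonTrivial prime}} (ℕᵈ.∣1⇒≡1 (≋0⇒∣ h))

  pow-≋ : ∀ {a n} → a ≋ + n → ∀ k → pow a k ≋ + (n ℕ.^ k)
  pow-≋ h zero = red-≋ (+ 1)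
  pow-≋ {a} {n} h (suc k) = ≋-trans (red-≋ _)
    (≋-trans (h ⟨*⟩ pow-≋ h k) (≋-reflexive (sym (ℤ.pos-* n (n ℕ.^ k)))))

  abstract
    natural-residue : ∀ a → ∃ λ n → a ≋ + n
    natural-residue a = go p refl
      where
      go : ∀ q → q ≡ p → ∃ λ n → a ≋ + n
      go zero    eq = contradiction (sym eq) (ℕ.≢-nonZero⁻¹ p {{prime⇒nonZero prime}})
      go (suc q) eq = a ℤ.%ℕ suc q , subst (λ m → Congruence._≋_ m a (+ (a ℤ.%ℕ suc q))) eq
                                       (Congruence.≋-sym (suc q) (Congruence.red-≋ (suc q) a))

  -- Since p = 2 + (p - 2), n · (n · n^(p-2)) = n^p ≡ n · 1 by Fermat, and one factor n cancels. The
  -- passage to a natural n is needed because `little` is stated for naturals.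
  inv-inverse : ∀ {a} → a ≉ + 0 → a * inv a ≋ + 1
  inv-inverse {a} a≉0 with natural-residue a
  ... | n , a≋n = ≋-trans (a≋n ⟨*⟩ pow-≋ (≋-trans (red-≋ a) a≋n) (p ∸ 2))
      (cancel {c = + n} n≉0 (≋-trans (≋-reflexive n^p) (≋-trans (little n) n≋n*1)))
    where
    open Fermat prime using (little)
    n≉0 : + n ≉ + 0
    n≉0 h = a≉0 (≋-trans a≋n h)
    n^p : + n * (+ n * + (n ℕ.^ (p ∸ 2))) ≡ + (n ℕ.^ p)
    n^p = trans (cong (+ n *_) (sym (ℤ.pos-* n _)))
      (trans (sym (ℤ.pos-* n _))
        (cong (λ m → + (n ℕ.^ m)) (ℕ.m+[n∸m]≡n (ℕ.nonTrivial⇒n>1 p {{prime⇒nonTrivial prime}}))))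
    n≋n*1 : + n ≋ + n * + 1
    n≋n*1 = ≋-reflexive (sym (ℤ.*-identityʳ (+ n)))

  abstract
    inverse : ∀ {a} → a ≉ + 0 → ∃ λ b → a * b ≋ + 1
    inverse {a} a≉0 = inv a , inv-inverse a≉0

  -- Lets a slope be specified by the equation l · d = n, so that the power `inv` disappears from
  -- all later computations.
  /'-unique : ∀ {n d n′ d′ l} → n ≋ n′ → d ≋ d′ → d′ ≉ + 0 → l * d′ ≋ n′ → n /' d ≋ l
  /'-unique {n} {d} {n′} {d′} {l} n≋n′ d≋d′ d′≉0 ld′≋n′ = ≋-trans (red-≋ _)
    (lin₃ l (inv-inverse (λ d≋0 → d′≉0 (≋-trans (≋-sym d≋d′) d≋0)))
          (- l * inv d) d≋d′
          (inv d) (≋-trans n≋n′ (≋-sym ld′≋n′))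
          (lemma n d d′ l (inv d)))
    where
    lemma : ∀ n d d′ l i → n * i - l ≡ l * (d * i - + 1) + - l * i * (d - d′) + i * (n - l * d′)
    lemma = solve-∀

  reduce-cong : ∀ {x x′ y y′} → x ≋ x′ → y ≋ y′ → reduce p x y ≡ reduce p x′ y′
  reduce-cong h k = cong₂ aff (red-cong h) (red-cong k)

  eq?-true : ∀ {a b} → a ≋ b → eq? a b ≡ true
  eq?-true {a} {b} h with red p a ℤ.≟ red p b
  ... | yes _ = refl
  ... | no ≢  = contradiction (red-cong h) ≢

  eq?-false : ∀ {a b} → a ≉ b → eq? a b ≡ false
  eq?-false {a} {b} h with red p a ℤ.≟ red p b
  ... | yes e = contradiction (red-injective e) h
  ... | no _  = refl

  _⟨+'⟩_ : ∀ {a b c d} → a ≋ b → c ≋ d → a +' c ≋ b + d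
  h ⟨+'⟩ k = ≋-trans (red-≋ _) (h ⟨+⟩ k)

  _⟨-'⟩_ : ∀ {a b c d} → a ≋ b → c ≋ d → a -' c ≋ b - d
  h ⟨-'⟩ k = ≋-trans (red-≋ _) (h ⟨-⟩ k)

  _⟨*'⟩_ : ∀ {a b c d} → a ≋ b → c ≋ d → a *' c ≋ b * d
  h ⟨*'⟩ k = ≋-trans (red-≋ _) (h ⟨*⟩ k)

  infixl 6 _⟨+'⟩_ _⟨-'⟩_
  infixl 7 _⟨*'⟩_

  module Addition (E : Weierstrass) where
    open Weierstrass E

    tangent : ℤ → ℤ → ℤ
    tangent x y = (c (+ 3) *' x *' x +' c (+ 2) *' a₂ *' x +' a₄ -' a₁ *' y)
                    /' (c (+ 2) *' y +' a₁ *' x +' a₃)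

    third : ℤ → ℤ → ℤ → ℤ → Point
    third l x₁ y₁ x₂ = aff x₃ (c (+ 0) -' (l +' a₁) *' x₃ -' (y₁ -' l *' x₁) -' a₃)
      where
      x₃ : ℤ
      x₃ = l *' l +' a₁ *' l -' a₂ -' x₁ -' x₂

    -- `tangent` and `third` repeat the formulas hidden in the `where` block of `add`; naming the
    -- outcomes of the two tests makes the unfolding hold by computation.
    add-aff : ∀ x₁ y₁ x₂ y₂ {b b′} →
      eq? x₁ x₂ ≡ b → eq? (y₁ +' y₂ +' a₁ *' x₂ +' a₃) (+ 0) ≡ b′ →
      add E p (aff x₁ y₁) (aff x₂ y₂) ≡
      (if b ∧ b′ then O
       else third (if b then tangent x₁ y₁ else (y₂ -' y₁) /' (x₂ -' x₁)) x₁ y₁ x₂)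
    add-aff x₁ y₁ x₂ y₂ refl refl = refl

    third-≋ : ∀ {l l′ x₁ y₁ x₂ x₃ y₃} → l′ ≋ l →
      x₃ ≋ l * l + a₁ * l - a₂ - x₁ - x₂ →
      y₃ ≋ - ((l + a₁) * x₃) - (y₁ - l * x₁) - a₃ →
      third l′ (red p x₁) (red p y₁) (red p x₂) ≡ reduce p x₃ y₃
    third-≋ {l} {l′} {x₁} {y₁} {x₂} {x₃} {y₃} l′≋l hx hy =
      cong₂ aff (red-cong (outer x≋)) (red-cong (outer y≋))
      where
      outer : ∀ {a b} → red p a ≋ b → a ≋ b
      outer {a} h = ≋-trans (≋-sym (red-≋ a)) h
      x≋ : l′ *' l′ +' a₁ *' l′ -' a₂ -' red p x₁ -' red p x₂ ≋ x₃
      x≋ = ≋-trans (l′≋l ⟨*'⟩ l′≋l ⟨+'⟩ ≋-refl {a₁} ⟨*'⟩ l′≋l ⟨-'⟩ ≋-refl ⟨-'⟩ red-≋ x₁ ⟨-'⟩ red-≋ x₂)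
             (≋-sym hx)
      y≋ : c (+ 0) -' (l′ +' a₁) *' (l′ *' l′ +' a₁ *' l′ -' a₂ -' red p x₁ -' red p x₂)
             -' (red p y₁ -' l′ *' red p x₁) -' a₃ ≋ y₃
      y≋ = ≋-trans
        (red-≋ (+ 0) ⟨-'⟩ (l′≋l ⟨+'⟩ ≋-refl) ⟨*'⟩ x≋ ⟨-'⟩ (red-≋ y₁ ⟨-'⟩ l′≋l ⟨*'⟩ red-≋ x₁) ⟨-'⟩ ≋-refl)
        (≋-trans (≋-reflexive (cong (λ z → z - (y₁ - l * x₁) - a₃) (ℤ.+-identityˡ (- ((l + a₁) * x₃)))))
          (≋-sym hy))

    add-chord : ∀ l {x₁ y₁ x₂ y₂ x₃ y₃} → x₁ ≉ x₂ → l * (x₂ - x₁) ≋ y₂ - y₁ →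
      x₃ ≋ l * l + a₁ * l - a₂ - x₁ - x₂ →
      y₃ ≋ - ((l + a₁) * x₃) - (y₁ - l * x₁) - a₃ →
      add E p (reduce p x₁ y₁) (reduce p x₂ y₂) ≡ reduce p x₃ y₃
    add-chord l {x₁} {y₁} {x₂} {y₂} x₁≉x₂ slope hx hy =
      trans (add-aff (red p x₁) (red p y₁) (red p x₂) (red p y₂) (eq?-false distinct) refl)
        (third-≋ {l} (/'-unique {l = l} (red-≋ y₂ ⟨-'⟩ red-≋ y₁) (red-≋ x₂ ⟨-'⟩ red-≋ x₁) x₂-x₁≉0 slope) hx hy)
      where
      distinct : red p x₁ ≉ red p x₂
      distinct h = x₁≉x₂ (≋-trans (≋-sym (red-≋ x₁)) (≋-trans h (red-≋ x₂)))
      x₂-x₁≉0 : x₂ - x₁ ≉ + 0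
      x₂-x₁≉0 h = x₁≉x₂ (lin₁ (- + 1) h (lemma x₁ x₂))
        where
        lemma : ∀ x₁ x₂ → x₁ - x₂ ≡ - + 1 * (x₂ - x₁ - + 0)
        lemma = solve-∀

    vertical-≋ : ∀ y₁ x₂ y₂ → red p y₁ +' red p y₂ +' a₁ *' red p x₂ +' a₃ ≋ y₁ + y₂ + a₁ * x₂ + a₃
    vertical-≋ y₁ x₂ y₂ = red-≋ y₁ ⟨+'⟩ red-≋ y₂ ⟨+'⟩ ≋-refl {a₁} ⟨*'⟩ red-≋ x₂ ⟨+'⟩ ≋-refl

    add-opposite : ∀ {x₁ y₁ x₂ y₂} → x₁ ≋ x₂ → y₁ + y₂ + a₁ * x₂ + a₃ ≋ + 0 →
      add E p (reduce p x₁ y₁) (reduce p x₂ y₂) ≡ O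
    add-opposite {x₁} {y₁} {x₂} {y₂} x₁≋x₂ h =
      add-aff (red p x₁) (red p y₁) (red p x₂) (red p y₂)
        (eq?-true (≋-trans (red-≋ x₁) (≋-trans x₁≋x₂ (≋-sym (red-≋ x₂)))))
        (eq?-true (≋-trans (vertical-≋ y₁ x₂ y₂) h))

    add-double : ∀ l {x y x₃ y₃} → + 2 * y + a₁ * x + a₃ ≉ + 0 →
      l * (+ 2 * y + a₁ * x + a₃) ≋ + 3 * x * x + + 2 * a₂ * x + a₄ - a₁ * y →
      x₃ ≋ l * l + a₁ * l - a₂ - x - x →
      y₃ ≋ - ((l + a₁) * x₃) - (y - l * x) - a₃ →
      add E p (reduce p x y) (reduce p x y) ≡ reduce p x₃ y₃
    add-double l {x} {y} d≉0 slope hx hy =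
      trans (add-aff (red p x) (red p y) (red p x) (red p y) (eq?-true ≋-refl) (eq?-false nonvertical))
        (third-≋ {l} (/'-unique {l = l}
          (red-≋ (+ 3) ⟨*'⟩ red-≋ x ⟨*'⟩ red-≋ x ⟨+'⟩ red-≋ (+ 2) ⟨*'⟩ ≋-refl {a₂} ⟨*'⟩ red-≋ x ⟨+'⟩ ≋-refl
            ⟨-'⟩ ≋-refl {a₁} ⟨*'⟩ red-≋ y)
          (red-≋ (+ 2) ⟨*'⟩ red-≋ y ⟨+'⟩ ≋-refl {a₁} ⟨*'⟩ red-≋ x ⟨+'⟩ ≋-refl) d≉0 slope) hx hy)
      where
      nonvertical : red p y +' red p y +' a₁ *' red p x +' a₃ ≉ + 0
      nonvertical h = d≉0 (≋-trans (≋-reflexive (lemma a₁ a₃ x y))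
                            (≋-trans (≋-sym (vertical-≋ y x y)) h))
        where
        lemma : ∀ a₁ a₃ x y → + 2 * y + a₁ * x + a₃ ≡ y + y + a₁ * x + a₃
        lemma = solve-∀

-- Translation by P and negation on E.

module Curves {p : ℕ} (prime : Prime p) (p≢2 : p ≢ 2) (p≢3 : p ≢ 3) where
  open import Data.Integer.Base using (_+_; _*_; _-_; -_)
  open PrimeField prime public
  open Addition Ecurve using (add-chord; add-opposite; add-double)

  nonzero : ∀ {a b} → a ≉ + 0 → b ≉ + 0 → a * b ≉ + 0
  nonzero {a} a≉0 b≉0 h with zero-product {a} h
  ... | inj₁ e = a≉0 e
  ... | inj₂ e = b≉0 e

  2≉0 : + 2 ≉ + 0
  2≉0 h = p≢2 (ℕ.≤-antisym (ℕᵈ.∣⇒≤ (≋0⇒∣ h)) (ℕ.nonTrivial⇒n>1 p {{prime⇒nonTrivial prime}}))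

  3≉0 : + 3 ≉ + 0
  3≉0 h = p≢3 (ℕ.≤-antisym (ℕᵈ.∣⇒≤ (≋0⇒∣ h))
    (ℕ.≤∧≢⇒< (ℕ.nonTrivial⇒n>1 p {{prime⇒nonTrivial prime}}) (p≢2 ∘ sym)))

  6≉0 : + 6 ≉ + 0
  6≉0 = nonzero {+ 2} {+ 3} 2≉0 3≉0

  9≉0 : + 9 ≉ + 0
  9≉0 = nonzero {+ 3} {+ 3} 3≉0 3≉0

  ½ : ℤ
  ½ = proj₁ (inverse 2≉0)

  2*½ : + 2 * ½ ≋ + 1
  2*½ = proj₂ (inverse 2≉0)

  record Curve (x y : ℤ) : Set where
    constructor curve
    field equation : y * y + x * y ≋ x * x * x + x * x - + 2 * x
  open Curve public

  data On : Point → Set where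
    on-O   : On O
    on-aff : ∀ {x y} → Curve x y → On (reduce p x y)

  third : ℤ → ℤ → ℤ
  third t l = l * l + l - + 7 - t

  -- The line of slope l through P = (2, 2) meets E again at the points
  -- with abscissas 2 + t and 2 + third t l; Chord is Vieta's product formula.
  record Chord (t l : ℤ) : Set where
    constructor vieta
    field product : t * third t l ≋ + 12 - + 6 * l
  open Chord public

  -- One constructor for each branch that `add` takes when P is added: identity, doubling, opposite
  -- points, chord.
  data View : Point → Set where
    at-O    : View O
    at-P    : View (reduce p (+ 2) (+ 2))
    at--P   : View (reduce p (+ 2) (- + 4))
    generic : ∀ t l → t ≉ + 0 → Chord t l → View (reduce p (+ 2 + t) (+ 2 + l * t))

  abstract
    -- At abscissa 2 the equation factors as (y - 2)(y + 4) = 0, so only P and -P lie there.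
    over-2 : ∀ {x y} → Curve x y → x ≋ + 2 → y ≋ + 2 ⊎ y ≋ - + 4
    over-2 {x} {y} h x≋2 = Sum.map (λ e → lin₁ (+ 1) e (lemma₁ y)) (λ e → lin₁ (+ 1) e (lemma₂ y))
      (zero-product {y - + 2} {y + + 4} (lin₂ (+ 1) (equation h) (x * x + + 3 * x + + 4 - y) x≋2 (factor x y)))
      where
      factor : ∀ x y → (y - + 2) * (y + + 4) - + 0 ≡
        + 1 * (y * y + x * y - (x * x * x + x * x - + 2 * x)) + (x * x + + 3 * x + + 4 - y) * (x - + 2)
      factor = solve-∀
      lemma₁ : ∀ y → y - + 2 ≡ + 1 * (y - + 2 - + 0)
      lemma₁ = solve-∀
      lemma₂ : ∀ y → y - - + 4 ≡ + 1 * (y + + 4 - + 0)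
      lemma₂ = solve-∀

  abstract
    quotient : ∀ {t} → t ≉ + 0 → ∀ y → ∃ λ l → l * t ≋ y
    quotient {t} t≉0 y with inverse t≉0
    ... | i , ti≋1 = y * i , lin₁ y ti≋1 (lemma t y i)
      where
      lemma : ∀ t y i → y * i * t - y ≡ y * (t * i - + 1)
      lemma = solve-∀

  curve-cong : ∀ {x y x′ y′} → x ≋ x′ → y ≋ y′ → Curve x y → Curve x′ y′
  curve-cong {x} {y} {x′} {y′} hx hy h = curve
    (lin₃ (+ 1) (equation h) (x * x + x * x′ + x′ * x′ + x + x′ - + 2 - y) hx (- (y + y′ + x′)) hy
      (lemma x y x′ y′))
    where
    lemma : ∀ x y x′ y′ → y′ * y′ + x′ * y′ - (x′ * x′ * x′ + x′ * x′ - + 2 * x′) ≡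
      + 1 * (y * y + x * y - (x * x * x + x * x - + 2 * x)) +
      (x * x + x * x′ + x′ * x′ + x + x′ - + 2 - y) * (x - x′) + - (y + y′ + x′) * (y - y′)
    lemma = solve-∀

  chord : ∀ t l → t ≉ + 0 → Curve (+ 2 + t) (+ 2 + l * t) → Chord t l
  chord t l t≉0 h = vieta (cancel {c = t} t≉0 (lin₁ (+ 1) (equation h) (lemma t l)))
    where
    lemma : ∀ t l → t * (t * (l * l + l - + 7 - t)) - t * (+ 12 - + 6 * l) ≡
      + 1 * ((+ 2 + l * t) * (+ 2 + l * t) + (+ 2 + t) * (+ 2 + l * t) -
        ((+ 2 + t) * (+ 2 + t) * (+ 2 + t) + (+ 2 + t) * (+ 2 + t) - + 2 * (+ 2 + t)))
    lemma = solve-∀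

  view-generic : ∀ {x y t} → t ≉ + 0 → x ≋ + 2 + t →
    Curve x y → View (reduce p x y)
  view-generic {x} {y} {t} t≉0 hx h with quotient t≉0 (y - + 2)
  ... | l , hl = subst View (sym (reduce-cong hx hy)) (generic t l t≉0 (chord t l t≉0 (curve-cong hx hy h)))
    where
    lemma : ∀ y s → y - (+ 2 + s) ≡ - + 1 * (s - (y - + 2))
    lemma = solve-∀
    hy : y ≋ + 2 + l * t
    hy = lin₁ (- + 1) hl (lemma y (l * t))

  abstract
    view : ∀ {X} → On X → View X
    view on-O = at-O
    view (on-aff {x} {y} h) with x ≋? + 2
    ... | no x≉2 = view-generic {t = x - + 2} (λ e → x≉2 (lin₁ (+ 1) e (lemma₁ x))) (≋-reflexive (lemma₂ x)) h
      where
      lemma₁ : ∀ x → x - + 2 ≡ + 1 * (x - + 2 - + 0)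
      lemma₁ = solve-∀
      lemma₂ : ∀ x → x ≡ + 2 + (x - + 2)
      lemma₂ = solve-∀
    ... | yes x≋2 with over-2 h x≋2
    ...   | inj₁ y≋2  = subst View (sym (reduce-cong x≋2 y≋2)) at-P
    ...   | inj₂ y≋-4 = subst View (sym (reduce-cong x≋2 y≋-4)) at--P

  neg : Point → Point
  neg O         = O
  neg (aff x y) = aff (red p x) (red p (- x - y))

  neg-reduce : ∀ x y → neg (reduce p x y) ≡ reduce p x (- x - y)
  neg-reduce x y = cong₂ aff (red-cong (red-≋ x))
    (red-cong (lin₂ (- + 1) (red-≋ x) (- + 1) (red-≋ y) (lemma (red p x) (red p y) x y)))
    where
    lemma : ∀ u v x y → - u - v - (- x - y) ≡ - + 1 * (u - x) + - + 1 * (v - y)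
    lemma = solve-∀

  neg-involutive : ∀ {X} → On X → neg (neg X) ≡ X
  neg-involutive on-O = refl
  neg-involutive (on-aff {x} {y} _) = trans (cong neg (neg-reduce x y)) (trans (neg-reduce x (- x - y))
    (reduce-cong ≋-refl (≋-reflexive (lemma x y))))
    where
    lemma : ∀ x y → - x - (- x - y) ≡ y
    lemma = solve-∀

  on-neg : ∀ {X} → On X → On (neg X)
  on-neg on-O = on-O
  on-neg (on-aff {x} {y} h) =
    subst On (sym (neg-reduce x y)) (on-aff (curve (lin₁ (+ 1) (equation h) (lemma x y))))
    where
    lemma : ∀ x y → (- x - y) * (- x - y) + x * (- x - y) - (x * x * x + x * x - + 2 * x) ≡
      + 1 * (y * y + x * y - (x * x * x + x * x - + 2 * x))
    lemma = solve-∀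

  abstract
    -- Opaque, so that goals keep `τ X` in place of the unfolded addition formula; `τ≡add` is the
    -- way back to `add`.
    τ : Point → Point
    τ = add Ecurve p (Pmod p)

    τ′ : Point → Point
    τ′ = add E'curve p (Rmod p)

    τ≡add : ∀ X → τ X ≡ add Ecurve p (Pmod p) X
    τ≡add X = refl

    τ′≡add : ∀ Y → τ′ Y ≡ add E'curve p (Rmod p) Y
    τ′≡add Y = refl

  τ-O : τ O ≡ reduce p (+ 2) (+ 2)
  τ-O = τ≡add O

  τ-P : τ (reduce p (+ 2) (+ 2)) ≡ reduce p (+ 1) (- + 1)
  -- The tangent to E at P has slope 12/6 = 2.
  τ-P = trans (τ≡add _) (add-double (+ 2) 6≉0 ≋-refl ≋-refl ≋-refl)

  τ--P : τ (reduce p (+ 2) (- + 4)) ≡ O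
  τ--P = trans (τ≡add _) (add-opposite {+ 2} {+ 2} {+ 2} { - + 4} ≋-refl ≋-refl)

  τ-generic : ∀ {t l} → t ≉ + 0 → Chord t l →
    τ (reduce p (+ 2 + t) (+ 2 + l * t)) ≡
    reduce p (+ 2 + third t l) (- + 4 - (l + + 1) * third t l)
  τ-generic {t} {l} t≉0 chord = trans (τ≡add _) (add-chord l {+ 2} {+ 2} distinct
    (≋-reflexive (slope t l)) (≋-reflexive (abscissa t l)) (≋-reflexive (ordinate t l)))
    where
    distinct : + 2 ≉ + 2 + t
    distinct h = t≉0 (lin₁ (- + 1) h (lemma t))
      where
      lemma : ∀ t → t - + 0 ≡ - + 1 * (+ 2 - (+ 2 + t))
      lemma = solve-∀
    slope : ∀ t l → l * (+ 2 + t - + 2) ≡ + 2 + l * t - + 2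
    slope = solve-∀
    abscissa : ∀ t l → + 2 + (l * l + l - + 7 - t) ≡ l * l + + 1 * l - + 1 - + 2 - (+ 2 + t)
    abscissa = solve-∀
    ordinate : ∀ t l → - + 4 - (l + + 1) * (l * l + l - + 7 - t) ≡
      - ((l + + 1) * (+ 2 + (l * l + l - + 7 - t))) - (+ 2 - l * + 2) - + 0
    ordinate = solve-∀

  abstract
    chord-third : ∀ {t l} → Chord t l → Chord (third t l) l
    chord-third {t} {l} h = vieta (lin₁ (+ 1) (product h) (lemma t l))
      where
      lemma : ∀ t l → (l * l + l - + 7 - t) * (l * l + l - + 7 - (l * l + l - + 7 - t)) - (+ 12 - + 6 * l) ≡
        + 1 * (t * (l * l + l - + 7 - t) - (+ 12 - + 6 * l))
      lemma = solve-∀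

  on-chord : ∀ {t l} → Chord t l → On (reduce p (+ 2 + t) (+ 2 + l * t))
  on-chord {t} {l} h = on-aff (curve (lin₁ t (product h) (lemma t l)))
    where
    lemma : ∀ t l → (+ 2 + l * t) * (+ 2 + l * t) + (+ 2 + t) * (+ 2 + l * t) -
      ((+ 2 + t) * (+ 2 + t) * (+ 2 + t) + (+ 2 + t) * (+ 2 + t) - + 2 * (+ 2 + t)) ≡
      t * (t * (l * l + l - + 7 - t) - (+ 12 - + 6 * l))
    lemma = solve-∀

  neg-line : ∀ t l → neg (reduce p (+ 2 + t) (+ 2 + l * t)) ≡ reduce p (+ 2 + t) (- + 4 - (l + + 1) * t)
  neg-line t l = trans (neg-reduce _ (+ 2 + l * t)) (reduce-cong ≋-refl (≋-reflexive (lemma t l)))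
    where
    lemma : ∀ t l → - (+ 2 + t) - (+ 2 + l * t) ≡ - + 4 - (l + + 1) * t
    lemma = solve-∀

  -- The line through P and X meets E again at -(P + X), which therefore has the same parametric
  -- form with the same l. Translating it swaps the two roots back.
  neg-τ-generic : ∀ {t l} → t ≉ + 0 → Chord t l →
    neg (τ (reduce p (+ 2 + t) (+ 2 + l * t))) ≡ reduce p (+ 2 + third t l) (+ 2 + l * third t l)
  neg-τ-generic {t} {l} t≉0 h = trans (cong neg (trans (τ-generic t≉0 h) (sym (neg-line (third t l) l))))
    (neg-involutive (on-chord (chord-third h)))

  on-τ : ∀ {X} → On X → On (τ X)
  on-τ o with view o
  ... | at-O  = subst On (sym τ-O) (on-aff (curve ≋-refl))
  ... | at-P  = subst On (sym τ-P) (on-aff (curve ≋-refl))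
  ... | at--P = subst On (sym τ--P) on-O
  ... | generic t l t≉0 h = subst On (sym (trans (τ-generic t≉0 h) (sym (neg-line (third t l) l))))
    (on-neg (on-chord (chord-third h)))

  -- If the third intersection lies over abscissa 2, the product of the roots vanishes, so 12 = 6l:
  -- the line is the tangent at P. This is the exceptional case X = -2P, where translating back
  -- requires doubling P.
  tangent-slope : ∀ {t l} → Chord t l → third t l ≋ + 0 → l ≋ + 2
  tangent-slope {t} {l} h t′≋0 = cancel {c = + 6} 6≉0 (lin₂ (+ 1) (product h) (- t) t′≋0 (lemma t l))
    where
    lemma : ∀ t l → + 6 * l - + 6 * + 2 ≡
      + 1 * (t * (l * l + l - + 7 - t) - (+ 12 - + 6 * l)) + - t * (l * l + l - + 7 - t - + 0)
    lemma = solve-∀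

  -- P − (P + X) = − X
  τ-neg-τ : ∀ {X} → On X → τ (neg (τ X)) ≡ neg X
  τ-neg-τ o with view o
  ... | at-O  = trans (cong (τ ∘ neg) τ-O) (trans (cong τ (neg-reduce (+ 2) (+ 2))) τ--P)
  ... | at-P  = trans (cong (τ ∘ neg) τ-P) (trans (cong τ (neg-reduce (+ 1) (- + 1)))
    (trans (τ-generic { - + 1} {+ 2} (λ h → 1≉0 (lin₁ (- + 1) h refl)) (vieta ≋-refl)) (sym (neg-reduce (+ 2) (+ 2)))))
  ... | at--P = trans (cong (τ ∘ neg) τ--P) (trans τ-O (sym (neg-reduce (+ 2) (- + 4))))
  ... | generic t l t≉0 h with third t l ≋? + 0
  ...   | no t′≉0 = trans (cong τ (neg-τ-generic t≉0 h)) (trans (τ-generic t′≉0 (chord-third h))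
            (trans (cong (λ s → reduce p (+ 2 + s) (- + 4 - (l + + 1) * s)) (involutive t l)) (sym (neg-line t l))))
    where
    involutive : ∀ t l → l * l + l - + 7 - (l * l + l - + 7 - t) ≡ t
    involutive = solve-∀
  ...   | yes t′≋0 = trans (cong τ (trans (neg-τ-generic t≉0 h) at-2))
            (trans τ-P (trans (reduce-cong (lin₁ (- + 1) t≋-1 (lemma₁ t))
              (lin₂ t l≋2 (+ 3) t≋-1 (lemma₂ t l))) (sym (neg-line t l))))
    where
    l≋2 : l ≋ + 2
    l≋2 = tangent-slope h t′≋0
    t≋-1 : t ≋ - + 1
    t≋-1 = lin₂ (- + 1) t′≋0 (l + + 3) l≋2 (lemma t l)
      where
      lemma : ∀ t l → t - - + 1 ≡ - + 1 * (l * l + l - + 7 - t - + 0) + (l + + 3) * (l - + 2)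
      lemma = solve-∀
    at-2 : reduce p (+ 2 + third t l) (+ 2 + l * third t l) ≡ reduce p (+ 2) (+ 2)
    at-2 = reduce-cong (≋-refl {+ 2} ⟨+⟩ t′≋0)
      (lin₁ l t′≋0 (lemma (third t l) l))
      where
      lemma : ∀ s l → + 2 + l * s - + 2 ≡ l * (s - + 0)
      lemma = solve-∀
    lemma₁ : ∀ t → + 1 - (+ 2 + t) ≡ - + 1 * (t - - + 1)
    lemma₁ = solve-∀
    lemma₂ : ∀ t l → - + 1 - (- + 4 - (l + + 1) * t) ≡ t * (l - + 2) + + 3 * (t - - + 1)
    lemma₂ = solve-∀

  τ-injective : ∀ {X Y} → On X → On Y → τ X ≡ τ Y → X ≡ Y
  τ-injective {X} {Y} oX oY eq = trans (sym (neg-involutive oX)) (trans (cong neg negs) (neg-involutive oY))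
    where
    negs : neg X ≡ neg Y
    negs = trans (sym (τ-neg-τ oX)) (trans (cong (τ ∘ neg) eq) (τ-neg-τ oY))

-- Compatibility of φ with translation by P and by R.

module Isogeny {p : ℕ} (prime : Prime p) (p≢2 : p ≢ 2) (p≢3 : p ≢ 3) where
  open import Data.Integer.Base using (_+_; _*_; _-_; -_)
  open Curves prime p≢2 p≢3
  open Addition E'curve using (add-chord; add-opposite; add-double)

  -- The graph of φ on E; r stands for 1/x.
  data Φ (X Y : Point) : Set where
    φ-O   : X ≡ O → Y ≡ O → Φ X Y
    φ-T   : X ≡ reduce p (+ 0) (+ 0) → Y ≡ O → Φ X Y
    φ-aff : ∀ x y r → x * r ≋ + 1 → X ≡ reduce p x y →
            Y ≡ reduce p (x - + 2 * r) (y + + 2 * r + + 2 * (r * r * y)) → Φ X Y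

  aff-injective : ∀ {x y x′ y′} → aff x y ≡ aff x′ y′ → x ≡ x′ × y ≡ y′
  aff-injective refl = refl , refl

  abstract
    reduce-injective : ∀ x y x′ y′ → reduce p x y ≡ reduce p x′ y′ → x ≋ x′ × y ≋ y′
    reduce-injective x y x′ y′ eq =
      red-injective (proj₁ (aff-injective eq)) , red-injective (proj₂ (aff-injective eq))

  φ-O⁻¹ : ∀ {Y} → Φ O Y → Y ≡ O
  φ-O⁻¹ (φ-O _ e) = e

  φ-aff⁻¹ : ∀ {x y Y} → Φ (reduce p x y) Y → (x ≋ + 0 × Y ≡ O) ⊎
    ∃ λ r → x * r ≋ + 1 × Y ≡ reduce p (x - + 2 * r) (y + + 2 * r + + 2 * (r * r * y))
  φ-aff⁻¹ {x} {y} (φ-T e e′) = inj₁ (proj₁ (reduce-injective x y (+ 0) (+ 0) e) , e′)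
  φ-aff⁻¹ {x} {y} (φ-aff x′ y′ r h e e′) with reduce-injective x y x′ y′ e
  ... | x≋x′ , y≋y′ = inj₂ (r , lin₂ (+ 1) h r x≋x′ (lemma₁ x x′ r) ,
    trans e′ (reduce-cong (lin₁ (- + 1) x≋x′ (lemma₂ x x′ r))
      (lin₁ (- (+ 1 + + 2 * (r * r))) y≋y′ (lemma₃ y y′ r))))
    where
    lemma₁ : ∀ x x′ r → x * r - + 1 ≡ + 1 * (x′ * r - + 1) + r * (x - x′)
    lemma₁ = solve-∀
    lemma₂ : ∀ x x′ r → x′ - + 2 * r - (x - + 2 * r) ≡ - + 1 * (x - x′)
    lemma₂ = solve-∀
    lemma₃ : ∀ y y′ r → y′ + + 2 * r + + 2 * (r * r * y′) - (y + + 2 * r + + 2 * (r * r * y)) ≡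
      - (+ 1 + + 2 * (r * r)) * (y - y′)
    lemma₃ = solve-∀

  φ-kernel : ∀ {X} → Φ X O → X ≡ O ⊎ X ≡ reduce p (+ 0) (+ 0)
  φ-kernel (φ-O e _) = inj₁ e
  φ-kernel (φ-T e _) = inj₂ e

  -- Evaluates φ at a known point from a known reciprocal `r₁`: inverses are unique, so the `r`
  -- stored in the graph agrees with it.
  φ-value : ∀ {x y Y} x₁ y₁ r₁ {x₂ y₂} → Φ (reduce p x y) Y → x ≋ x₁ → y ≋ y₁ → x₁ * r₁ ≋ + 1 →
    x₁ - + 2 * r₁ ≋ x₂ → y₁ + + 2 * r₁ + + 2 * (r₁ * r₁ * y₁) ≋ y₂ → Y ≡ reduce p x₂ y₂
  φ-value {x} {y} x₁ y₁ r₁ {x₂} {y₂} f hx hy h₁ e₁ e₂ with φ-aff⁻¹ f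
  ... | inj₁ (x≋0 , _) = contradiction
    (lin₃ r₁ x≋0 (- r₁) hx (- + 1) h₁ (lemma x x₁ r₁)) 1≉0
    where
    lemma : ∀ x x₁ r₁ → + 1 - + 0 ≡ r₁ * (x - + 0) + - r₁ * (x - x₁) + - + 1 * (x₁ * r₁ - + 1)
    lemma = solve-∀
  ... | inj₂ (r , h , e) = trans e (reduce-cong
    (lin₃ (+ 1) hx (- + 2) r≋r₁ (+ 1) e₁ (lemma₁ x x₁ r r₁ x₂))
    (≋-trans (lin₂ (+ 1 + + 2 * (r * r)) hy (+ 2 + + 2 * y₁ * (r + r₁)) r≋r₁ (lemma₂ y y₁ r r₁)) e₂))
    where
    lemma : ∀ x x₁ r r₁ → r - r₁ ≡ r₁ * (x * r - + 1) + - (r * r₁) * (x - x₁) + - r * (x₁ * r₁ - + 1)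
    lemma = solve-∀
    r≋r₁ : r ≋ r₁
    r≋r₁ = lin₃ r₁ h (- (r * r₁)) hx (- r) h₁ (lemma x x₁ r r₁)
    lemma₁ : ∀ x x₁ r r₁ x₂ → x - + 2 * r - x₂ ≡ + 1 * (x - x₁) + - + 2 * (r - r₁) + + 1 * (x₁ - + 2 * r₁ - x₂)
    lemma₁ = solve-∀
    lemma₂ : ∀ y y₁ r r₁ → y + + 2 * r + + 2 * (r * r * y) - (y₁ + + 2 * r₁ + + 2 * (r₁ * r₁ * y₁)) ≡
      (+ 1 + + 2 * (r * r)) * (y - y₁) + (+ 2 + + 2 * y₁ * (r + r₁)) * (r - r₁)
    lemma₂ = solve-∀

  τ′-R : τ′ (reduce p (+ 1) (+ 4)) ≡ reduce p (- + 1) (- + 1)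
  -- The tangent to E' at R has slope 9/9 = 1.
  τ′-R = trans (τ′≡add _) (add-double (+ 1) 9≉0 ≋-refl ≋-refl ≋-refl)

  τ′--R : τ′ (reduce p (+ 1) (- + 5)) ≡ O
  τ′--R = trans (τ′≡add _) (add-opposite {+ 1} {+ 4} {+ 1} { - + 5} ≋-refl ≋-refl)

  -- For X = (2 + t, 2 + l t) the slopes l, m of the lines joining P to X and
  -- to X + T satisfy (l − 1)(m − 1) = −1, so with ρ = 1/(l − 1) everything
  -- about X + T and about the line joining R to φ X is polynomial in l and ρ.
  key : ∀ {t l} → Chord t l →
    (+ 2 + t) * (+ 2 + third t l) ≋ + 2 * ((l - + 1) * (l - + 1))
  key {t} {l} h = lin₁ (+ 1) (product h) (lemma t l)
    where
    lemma : ∀ t l → (+ 2 + t) * (+ 2 + (l * l + l - + 7 - t)) - + 2 * ((l - + 1) * (l - + 1)) ≡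
      + 1 * (t * (l * l + l - + 7 - t) - (+ 12 - + 6 * l))
    lemma = solve-∀

  -- The point X + T has abscissa -2r and lies on the line through P of slope 1 - ρ, so its ordinate
  -- is 2ρ + (ρ - 1) · 2r; adding the ordinate of X gives that of φX.
  φ-ordinate : ∀ {t l r ρ} → Chord t l → (+ 2 + t) * r ≋ + 1 → ρ * (l - + 1) ≋ + 1 →
    (+ 2 + l * t) + + 2 * r + + 2 * (r * r * (+ 2 + l * t)) ≋
    (+ 2 + l * t) + + 2 * ρ + (ρ - + 1) * (+ 2 * r)
  φ-ordinate {t} {l} {r} {ρ} h hr hρ =
    lin₂ (+ 2 * (r * r)) M (+ 2 * ρ * ((+ 2 + t) * r + + 1) + + 2 * ρ * r - + 4 * r) hr
      (lemma₂ t (l * t) r ρ)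
    where
    lemma₁ : ∀ t l ρ → + 2 * (+ 2 + t) + (+ 2 + l * t) - ρ * ((+ 2 + t) * (+ 3 + t)) ≡
      ρ * (t * (l * l + l - + 7 - t) - (+ 12 - + 6 * l)) +
      - (+ 2 * (+ 2 + t) + (+ 2 + l * t)) * (ρ * (l - + 1) - + 1)
    lemma₁ = solve-∀
    M : + 2 * (+ 2 + t) + (+ 2 + l * t) ≋ ρ * ((+ 2 + t) * (+ 3 + t))
    M = lin₂ ρ (product h) (- (+ 2 * (+ 2 + t) + (+ 2 + l * t))) hρ (lemma₁ t l ρ)
    lemma₂ : ∀ t s r ρ → (+ 2 + s) + + 2 * r + + 2 * (r * r * (+ 2 + s)) -
      ((+ 2 + s) + + 2 * ρ + (ρ - + 1) * (+ 2 * r)) ≡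
      + 2 * (r * r) * (+ 2 * (+ 2 + t) + (+ 2 + s) - ρ * ((+ 2 + t) * (+ 3 + t))) +
      (+ 2 * ρ * ((+ 2 + t) * r + + 1) + + 2 * ρ * r - + 4 * r) * ((+ 2 + t) * r - + 1)
    lemma₂ = solve-∀

  -- Divide `key` by x and by (l - 1)². This expresses -2/x, the abscissa of X + T, without division
  -- by x.
  reciprocal : ∀ {x x₃ r l ρ} → x * r ≋ + 1 → x * x₃ ≋ + 2 * ((l - + 1) * (l - + 1)) → ρ * (l - + 1) ≋ + 1 →
    + 2 * r ≋ x₃ * (ρ * ρ)
  reciprocal {x} {x₃} {r} {l} {ρ} hr hx hρ =
    lin₃ (x₃ * (ρ * ρ)) hr (- (r * (ρ * ρ))) hx (- (+ 2 * r * (ρ * (l - + 1) + + 1))) hρ (lemma x x₃ r l ρ)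
    where
    lemma : ∀ x x₃ r l ρ → + 2 * r - x₃ * (ρ * ρ) ≡
      x₃ * (ρ * ρ) * (x * r - + 1) + - (r * (ρ * ρ)) * (x * x₃ - + 2 * ((l - + 1) * (l - + 1))) +
      - (+ 2 * r * (ρ * (l - + 1) + + 1)) * (ρ * (l - + 1) - + 1)
    lemma = solve-∀

  -- Uses l² + l - 3 = (l - 1)(l + 2) - 1, so that multiplying by ρ clears the factor l - 1.
  slope-relation : ∀ {x x₃ z l ρ} → z ≋ x₃ * (ρ * ρ) → ρ * (l - + 1) ≋ + 1 → x + x₃ ≡ l * l + l - + 3 →
    (l - + 1) * z ≋ l + + 2 - ρ * (x + + 1)
  slope-relation {x} {x₃} {z} {l} {ρ} hz hρ hs =
    lin₃ (l - + 1) hz (ρ * x₃ + l + + 2) hρ ρ (≋-reflexive hs) (lemma x x₃ z l ρ)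
    where
    lemma : ∀ x x₃ z l ρ → (l - + 1) * z - (l + + 2 - ρ * (x + + 1)) ≡
      (l - + 1) * (z - x₃ * (ρ * ρ)) + (ρ * x₃ + l + + 2) * (ρ * (l - + 1) - + 1) +
      ρ * (x + x₃ - (l * l + l - + 3))
    lemma = solve-∀

  -- The line of slope 1 through P is y = x. It meets E again at T, where t = -2, and at T - P =
  -- (-1, -1), where t = -3. Here l - 1 has no inverse, so these points are treated separately.
  factor-3 : ∀ {t l} → Chord t l → l ≋ + 1 → t ≋ - + 2 ⊎ t ≋ - + 3
  factor-3 {t} {l} h l≋1 = Sum.map (λ e → lin₁ (+ 1) e (lemma₂ t)) (λ e → lin₁ (+ 1) e (lemma₃ t))
    (zero-product {t + + 2} {t + + 3} (lin₂ (- + 1) (product h) (t * (l + + 2) + + 6) l≋1 (lemma₁ t l)))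
    where
    lemma₁ : ∀ t l → (t + + 2) * (t + + 3) - + 0 ≡
      - + 1 * (t * (l * l + l - + 7 - t) - (+ 12 - + 6 * l)) + (t * (l + + 2) + + 6) * (l - + 1)
    lemma₁ = solve-∀
    lemma₂ : ∀ t → t - - + 2 ≡ + 1 * (t + + 2 - + 0)
    lemma₂ = solve-∀
    lemma₃ : ∀ t → t - - + 3 ≡ + 1 * (t + + 3 - + 0)
    lemma₃ = solve-∀

  abstract
    l-1≉0 : ∀ {l} → l ≉ + 1 → l - + 1 ≉ + 0
    l-1≉0 {l} l≉1 e = l≉1 (lin₁ (+ 1) e (lemma l))
      where
      lemma : ∀ l → l - + 1 ≡ + 1 * (l - + 1 - + 0)
      lemma = solve-∀

  abstract
    -- Over abscissa -1 lie T - P = (-1, -1), seen from P with slope 1, and T + P = (-1, 2), seen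
    -- with slope 0.
    slope-0 : ∀ {t l} → Chord t l → l ≉ + 1 → t ≋ - + 3 → l ≋ + 0
    slope-0 {t} {l} h l≉1 t≋-3 = cancel {c = + 3} 3≉0 (cancel {c = l - + 1} (l-1≉0 l≉1)
      (lin₂ (- + 1) (product h) (l * l + l - + 4 - t) t≋-3 (lemma t l)))
      where
      lemma : ∀ t l → (l - + 1) * (+ 3 * l) - (l - + 1) * (+ 3 * + 0) ≡
        - + 1 * (t * (l * l + l - + 7 - t) - (+ 12 - + 6 * l)) + (l * l + l - + 4 - t) * (t - - + 3)
      lemma = solve-∀

  abstract
    x≉0 : ∀ {t l} → Chord t l → l ≉ + 1 → + 2 + t ≉ + 0
    x≉0 {t} {l} h l≉1 e = nonzero {+ 2} {(l - + 1) * (l - + 1)} 2≉0 (nonzero (l-1≉0 l≉1) (l-1≉0 l≉1))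
      (lin₂ (+ 2 + third t l) e (- + 1) (key h) (lemma (+ 2 + t) (+ 2 + third t l) ((l - + 1) * (l - + 1))))
      where
      lemma : ∀ x x₃ d → + 2 * d - + 0 ≡ x₃ * (x - + 0) + - + 1 * (x * x₃ - + 2 * d)
      lemma = solve-∀

  module Generic {t l : ℤ} (t≉0 : t ≉ + 0) (h : Chord t l) where
    X : Point
    X = reduce p (+ 2 + t) (+ 2 + l * t)

    t′ : ℤ
    t′ = third t l

    τX : ∀ {x y} → + 2 + t′ ≋ x → - + 4 - (l + + 1) * t′ ≋ y → τ X ≡ reduce p x y
    τX hx hy = trans (τ-generic t≉0 h) (reduce-cong hx hy)

    at-T : ∀ {Y} → l ≋ + 1 → t ≋ - + 2 → Φ X Y → Φ (τ X) (τ′ Y)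
    at-T {Y} l≋1 t≋-2 f with φ-aff⁻¹ f
    ... | inj₁ (_ , e) = φ-aff (- + 1) (+ 2) (- + 1) ≋-refl (τX
        (lin₂ (l + + 2) l≋1 (- + 1) t≋-2 (lemma₁ t l))
        (lin₂ (+ 3 - (l + + 1) * (l + + 2)) l≋1 (l + + 1) t≋-2 (lemma₂ t l))) (trans (cong τ′ e) (τ′≡add O))
      where
      lemma₁ : ∀ t l → + 2 + (l * l + l - + 7 - t) - - + 1 ≡ (l + + 2) * (l - + 1) + - + 1 * (t - - + 2)
      lemma₁ = solve-∀
      lemma₂ : ∀ t l → - + 4 - (l + + 1) * (l * l + l - + 7 - t) - + 2 ≡
        (+ 3 - (l + + 1) * (l + + 2)) * (l - + 1) + (l + + 1) * (t - - + 2)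
      lemma₂ = solve-∀
    ... | inj₂ (r , hr , _) = contradiction (lin₂ (- + 1) hr r t≋-2 (lemma t r)) 1≉0
      where
      lemma : ∀ t r → + 1 - + 0 ≡ - + 1 * ((+ 2 + t) * r - + 1) + r * (t - - + 2)
      lemma = solve-∀

    -- Here X = T - P, so φX = -R and the sum on E' is O, matching φT = O.
    at-T-P : ∀ {Y} → l ≋ + 1 → t ≋ - + 3 → Φ X Y → Φ (τ X) (τ′ Y)
    at-T-P {Y} l≋1 t≋-3 f = φ-T (τX
        (lin₂ (l + + 2) l≋1 (- + 1) t≋-3 (lemma₁ t l))
        (lin₂ (+ 2 - (l + + 1) * (l + + 2)) l≋1 (l + + 1) t≋-3 (lemma₂ t l)))
      (trans (cong τ′ Y≡) τ′--R)
      where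
      lemma₁ : ∀ t l → + 2 + (l * l + l - + 7 - t) - + 0 ≡ (l + + 2) * (l - + 1) + - + 1 * (t - - + 3)
      lemma₁ = solve-∀
      lemma₂ : ∀ t l → - + 4 - (l + + 1) * (l * l + l - + 7 - t) - + 0 ≡
        (+ 2 - (l + + 1) * (l + + 2)) * (l - + 1) + (l + + 1) * (t - - + 3)
      lemma₂ = solve-∀
      lemma₃ : ∀ t → + 2 + t - - + 1 ≡ + 1 * (t - - + 3)
      lemma₃ = solve-∀
      lemma₄ : ∀ t l → + 2 + l * t - - + 1 ≡ t * (l - + 1) + + 1 * (t - - + 3)
      lemma₄ = solve-∀
      Y≡ : Y ≡ reduce p (+ 1) (- + 5)
      Y≡ = φ-value (- + 1) (- + 1) (- + 1) f (lin₁ (+ 1) t≋-3 (lemma₃ t))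
        (lin₂ t l≋1 (+ 1) t≋-3 (lemma₄ t l)) ≋-refl ≋-refl ≋-refl

    -- Here X = T + P, so φX = R and the chord on E' degenerates to the tangent at R; the new point
    -- 2P + T is (-2, 0).
    at-T+P : ∀ {Y} → l ≋ + 0 → t ≋ - + 3 → Φ X Y → Φ (τ X) (τ′ Y)
    at-T+P {Y} l≋0 t≋-3 f = φ-aff (- + 2) (+ 0) (- ½) (lin₁ (+ 1) 2*½ (lemma₅ ½)) (τX
        (lin₂ (l + + 1) l≋0 (- + 1) t≋-3 (lemma₁ t l))
        (lin₂ (+ 4 - (l + + 1) * (l + + 1)) l≋0 (l + + 1) t≋-3 (lemma₂ t l)))
      (trans (cong τ′ Y≡) (trans τ′-R (reduce-cong (lin₁ (- + 1) 2*½ (lemma₆ ½)) (lin₁ (+ 1) 2*½ (lemma₇ ½)))))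
      where
      lemma₁ : ∀ t l → + 2 + (l * l + l - + 7 - t) - - + 2 ≡ (l + + 1) * (l - + 0) + - + 1 * (t - - + 3)
      lemma₁ = solve-∀
      lemma₂ : ∀ t l → - + 4 - (l + + 1) * (l * l + l - + 7 - t) - + 0 ≡
        (+ 4 - (l + + 1) * (l + + 1)) * (l - + 0) + (l + + 1) * (t - - + 3)
      lemma₂ = solve-∀
      lemma₃ : ∀ t → + 2 + t - - + 1 ≡ + 1 * (t - - + 3)
      lemma₃ = solve-∀
      lemma₄ : ∀ t l → + 2 + l * t - + 2 ≡ t * (l - + 0)
      lemma₄ = solve-∀
      lemma₅ : ∀ r → - + 2 * - r - + 1 ≡ + 1 * (+ 2 * r - + 1)
      lemma₅ = solve-∀
      lemma₆ : ∀ r → - + 1 - (- + 2 - + 2 * - r) ≡ - + 1 * (+ 2 * r - + 1)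
      lemma₆ = solve-∀
      lemma₇ : ∀ r → - + 1 - (+ 0 + + 2 * - r + + 2 * (- r * - r * + 0)) ≡ + 1 * (+ 2 * r - + 1)
      lemma₇ = solve-∀
      Y≡ : Y ≡ reduce p (+ 1) (+ 4)
      Y≡ = φ-value (- + 1) (+ 2) (- + 1) f (lin₁ (+ 1) t≋-3 (lemma₃ t))
        (lin₁ t l≋0 (lemma₄ t l)) ≋-refl ≋-refl ≋-refl

    module Line {r r₃ ρ : ℤ} (hr : (+ 2 + t) * r ≋ + 1) (hr₃ : (+ 2 + t′) * r₃ ≋ + 1)
                (hρ : ρ * (l - + 1) ≋ + 1) (t≉-3 : t ≉ - + 3) where
      hz : + 2 * r ≋ (+ 2 + t′) * (ρ * ρ)
      hz = reciprocal {+ 2 + t} {+ 2 + t′} {r} {l} {ρ} hr (key h) hρ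

      hz₃ : + 2 * r₃ ≋ (+ 2 + t) * (ρ * ρ)
      hz₃ = reciprocal {+ 2 + t′} {+ 2 + t} {r₃} {l} {ρ} hr₃ (≋-trans (≋-reflexive (ℤ.*-comm (+ 2 + t′) (+ 2 + t))) (key h)) hρ

      G : (l - + 1) * (+ 2 * r) ≋ l + + 2 - ρ * (+ 2 + t + + 1)
      G = slope-relation {+ 2 + t} {+ 2 + t′} {+ 2 * r} {l} {ρ} hz hρ (lemma t l)
        where
        lemma : ∀ t l → + 2 + t + (+ 2 + (l * l + l - + 7 - t)) ≡ l * l + l - + 3
        lemma = solve-∀

      G₃ : (l - + 1) * (+ 2 * r₃) ≋ l + + 2 - ρ * (+ 2 + t′ + + 1)
      G₃ = slope-relation {+ 2 + t′} {+ 2 + t} {+ 2 * r₃} {l} {ρ} hz₃ hρ (lemma t l)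
        where
        lemma : ∀ t l → + 2 + (l * l + l - + 7 - t) + (+ 2 + t) ≡ l * l + l - + 3
        lemma = solve-∀

      -- The abscissa of φX is 1 only if x - 2/x = 1, that is t(t + 3) = 0: X would be ±P or ±P + T.
      distinct : + 1 ≉ + 2 + t - + 2 * r
      distinct e = nonzero t≉0 t+3≉0 (lin₂ (- (+ 2 + t)) e (+ 2) hr (lemma t r))
        where
        lemma : ∀ t r → t * (t + + 3) - + 0 ≡
          - (+ 2 + t) * (+ 1 - (+ 2 + t - + 2 * r)) + + 2 * ((+ 2 + t) * r - + 1)
        lemma = solve-∀
        lemma₂ : ∀ t → t - - + 3 ≡ + 1 * (t + + 3 - + 0)
        lemma₂ = solve-∀
        t+3≉0 : t + + 3 ≉ + 0
        t+3≉0 e′ = t≉-3 (lin₁ (+ 1) e′ (lemma₂ t))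

      -- With m = 1 - ρ the slope from P to X + T, the line from R to φX has slope l + m - 1 = l -
      -- ρ.
      slope : (l - ρ) * (+ 2 + t - + 2 * r - + 1) ≋
        (+ 2 + l * t) + + 2 * r + + 2 * (r * r * (+ 2 + l * t)) - + 4
      slope = lin₂ (- + 1) (φ-ordinate {t} {l} {r} {ρ} h hr hρ) (- + 1) G
        (lemma t l ρ (+ 2 * r) ((+ 2 + l * t) + + 2 * r + + 2 * (r * r * (+ 2 + l * t))))
        where
        lemma : ∀ t l ρ z y → (l - ρ) * (+ 2 + t - z - + 1) - (y - + 4) ≡
          - + 1 * (y - (+ 2 + l * t + + 2 * ρ + (ρ - + 1) * z)) +
          - + 1 * ((l - + 1) * z - (l + + 2 - ρ * (+ 2 + t + + 1)))
        lemma = solve-∀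

      abscissa : + 2 + t′ - + 2 * r₃ ≋
        (l - ρ) * (l - ρ) + + 1 * (l - ρ) - + 1 - + 1 - (+ 2 + t - + 2 * r)
      abscissa = lin₃ (- + 1) hz (- + 1) hz₃ (- (+ 3 * ρ + ρ * (l - + 1) - + 1)) hρ
        (lemma t l ρ (+ 2 * r) (+ 2 * r₃))
        where
        lemma : ∀ t l ρ z z₃ → + 2 + (l * l + l - + 7 - t) - z₃ -
            ((l - ρ) * (l - ρ) + + 1 * (l - ρ) - + 1 - + 1 - (+ 2 + t - z)) ≡
          - + 1 * (z - (+ 2 + (l * l + l - + 7 - t)) * (ρ * ρ)) + - + 1 * (z₃ - (+ 2 + t) * (ρ * ρ)) +
          - (+ 3 * ρ + ρ * (l - + 1) - + 1) * (ρ * (l - + 1) - + 1)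
        lemma = solve-∀

      y₃ : ℤ
      y₃ = - + 4 - (l + + 1) * t′

      ordinate : y₃ + + 2 * r₃ + + 2 * (r₃ * r₃ * y₃) ≋
        - ((l - ρ + + 1) * (+ 2 + t′ - + 2 * r₃)) - (+ 4 - (l - ρ) * + 1) - + 0
      ordinate = lin₃ (- + 1) (φ-ordinate {t′} {l} {r₃} {ρ} (chord-third h) hr₃ hρ) (- (+ 2 * r₃)) hr₃ (- + 1) G₃
        (lemma t′ l ρ r₃)
        where
        lemma : ∀ s l ρ r₃ → - + 4 - (l + + 1) * s + + 2 * r₃ + + 2 * (r₃ * r₃ * (- + 4 - (l + + 1) * s)) -
            (- ((l - ρ + + 1) * (+ 2 + s - + 2 * r₃)) - (+ 4 - (l - ρ) * + 1) - + 0) ≡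
          - + 1 * ((+ 2 + l * s) + + 2 * r₃ + + 2 * (r₃ * r₃ * (+ 2 + l * s)) -
            (+ 2 + l * s + + 2 * ρ + (ρ - + 1) * (+ 2 * r₃))) +
          - (+ 2 * r₃) * ((+ 2 + s) * r₃ - + 1) +
          - + 1 * ((l - + 1) * (+ 2 * r₃) - (l + + 2 - ρ * (+ 2 + s + + 1)))
        lemma = solve-∀

      result : ∀ {Y} → Y ≡ reduce p (+ 2 + t - + 2 * r) ((+ 2 + l * t) + + 2 * r + + 2 * (r * r * (+ 2 + l * t))) →
        Φ (τ X) (τ′ Y)
      result e = φ-aff (+ 2 + t′) y₃ r₃ hr₃ (τ-generic t≉0 h) (trans (cong τ′ e)
        (trans (τ′≡add _) (add-chord (l - ρ) {+ 1} {+ 4} distinct slope abscissa ordinate)))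

    off-line : ∀ {Y} → l ≉ + 1 → t ≉ - + 3 → Φ X Y → Φ (τ X) (τ′ Y)
    off-line {Y} l≉1 t≉-3 f =
      choose (φ-aff⁻¹ f) (inverse (x≉0 (chord-third h) l≉1)) (quotient (l-1≉0 l≉1) (+ 1))
      where
      choose : (+ 2 + t ≋ + 0 × Y ≡ O) ⊎ (∃ λ r → (+ 2 + t) * r ≋ + 1 ×
          Y ≡ reduce p (+ 2 + t - + 2 * r) ((+ 2 + l * t) + + 2 * r + + 2 * (r * r * (+ 2 + l * t)))) →
        (∃ λ r₃ → (+ 2 + t′) * r₃ ≋ + 1) → (∃ λ ρ → ρ * (l - + 1) ≋ + 1) → Φ (τ X) (τ′ Y)
      choose (inj₁ (x≋0 , _)) _ _ = contradiction x≋0 (x≉0 h l≉1)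
      choose (inj₂ (r , hr , e)) (r₃ , hr₃) (ρ , hρ) = Line.result {r} {r₃} {ρ} hr hr₃ hρ t≉-3 e

    abstract
      step : ∀ {Y} → Φ X Y → Φ (τ X) (τ′ Y)
      step f with l ≋? + 1
      step f | yes l≋1 with factor-3 h l≋1
      ... | inj₁ t≋-2 = at-T l≋1 t≋-2 f
      ... | inj₂ t≋-3 = at-T-P l≋1 t≋-3 f
      step f | no l≉1 with t ≋? - + 3
      ... | yes t≋-3 = at-T+P (slope-0 h l≉1 t≋-3) t≋-3 f
      ... | no t≉-3  = off-line l≉1 t≉-3 f

  abstract
    Φ-step : ∀ {X Y} → On X → Φ X Y → Φ (τ X) (τ′ Y)
    Φ-step o f with view o
    ... | at-O = φ-aff (+ 2) (+ 2) ½ 2*½ τ-O (trans (trans (cong τ′ (φ-O⁻¹ f)) (τ′≡add O))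
        (reduce-cong (lin₁ (+ 1) 2*½ (lemma₁ ½)) (lin₁ (- (+ 2 * ½ + + 2)) 2*½ (lemma₂ ½))))
      where
      lemma₁ : ∀ h → + 1 - (+ 2 - + 2 * h) ≡ + 1 * (+ 2 * h - + 1)
      lemma₁ = solve-∀
      lemma₂ : ∀ h → + 4 - (+ 2 + + 2 * h + + 2 * (h * h * + 2)) ≡ - (+ 2 * h + + 2) * (+ 2 * h - + 1)
      lemma₂ = solve-∀
    ... | at-P = φ-aff (+ 1) (- + 1) (+ 1) ≋-refl τ-P (trans (cong τ′ (φ-value (+ 2) (+ 2) ½ f ≋-refl ≋-refl 2*½
      (lin₁ (- + 1) 2*½ (lemma₁ ½)) (lin₁ (+ 2 * ½ + + 2) 2*½ (lemma₂ ½)))) τ′-R)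
      where
      lemma₁ : ∀ h → + 2 - + 2 * h - + 1 ≡ - + 1 * (+ 2 * h - + 1)
      lemma₁ = solve-∀
      lemma₂ : ∀ h → + 2 + + 2 * h + + 2 * (h * h * + 2) - + 4 ≡ (+ 2 * h + + 2) * (+ 2 * h - + 1)
      lemma₂ = solve-∀
    ... | at--P = φ-O τ--P (trans (cong τ′ (φ-value (+ 2) (- + 4) ½ f ≋-refl ≋-refl 2*½
      (lin₁ (- + 1) 2*½ (lemma₁ ½)) (lin₁ (- (+ 4 * ½ + + 1)) 2*½ (lemma₂ ½)))) τ′--R)
      where
      lemma₁ : ∀ h → + 2 - + 2 * h - + 1 ≡ - + 1 * (+ 2 * h - + 1)
      lemma₁ = solve-∀
      lemma₂ : ∀ h → - + 4 + + 2 * h + + 2 * (h * h * - + 4) - - + 5 ≡ - (+ 4 * h + + 1) * (+ 2 * h - + 1)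
      lemma₂ = solve-∀
    ... | generic t l t≉0 h = Generic.step t≉0 h f

-- Integrality of the Somos-5 sequence.

module SomosIntegrality where
  open import Data.Nat.Base using (_+_; _*_)
  open import Data.Nat.Divisibility using (_∣_)
  open Coprimality using (Coprime; coprime-divisor)

  -- The last field is the conserved quantity of the recurrence, cleared of
  -- denominators: w + v + 1/w + 1/v + 1/(w v) = 5 for w = a d / (b c), v = b e / (c d).
  record Window (a b c d e : ℕ) : Set where
    field
      a≢0 : NonZero a
      b≢0 : NonZero b
      c≢0 : NonZero c
      d≢0 : NonZero d
      e≢0 : NonZero e
      a⊥b : Coprime a b
      a⊥c : Coprime a c
      b⊥c : Coprime b c
      b⊥d : Coprime b d
      c⊥d : Coprime c d
      c⊥e : Coprime c e
      d⊥e : Coprime d e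
      conserved : (a * (d * d) + b * b * e) * (a * e + c * c) + c * c * (b * c * d) ≡ 5 * (a * e) * (b * c * d)

  coprime-product : ∀ {m n k} → Coprime m n → Coprime m k → Coprime m (n * k)
  coprime-product m⊥n m⊥k (g∣m , g∣nk) =
    m⊥k (g∣m , coprime-divisor (λ (h∣g , h∣n) → m⊥n (ℕᵈ.∣-trans h∣g g∣m , h∣n)) g∣nk)

  -- Modulo a the conserved identity reduces to c² b (e b + d c) ≡ 0, and a is coprime to b and c.
  exact : ∀ {a b c d e} → Window a b c d e → a ∣ e * b + d * c
  exact {a} {b} {c} {d} {e} win = coprime-divisor {a} {c * c * b}
    (coprime-product {a} {c * c} (coprime-product {a} {c} a⊥c a⊥c) a⊥b)
    (ℕᵈ.∣m+n∣m⇒∣n (subst (a ∣_) (trans (sym conserved) (lemma a b c d e)) (subst (a ∣_) (lemma₂ a b c d e) (ℕᵈ.m∣m*n _)))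
      (ℕᵈ.m∣m*n (d * d * (a * e + c * c) + b * b * e * e)))
    where
    open Window win
    lemma : ∀ a b c d e → (a * (d * d) + b * b * e) * (a * e + c * c) + c * c * (b * c * d) ≡
      a * (d * d * (a * e + c * c) + b * b * e * e) + c * c * b * (e * b + d * c)
    lemma = ℕ-Solver.solve-∀
    lemma₂ : ∀ a b c d e → a * (5 * e * (b * c * d)) ≡ 5 * (a * e) * (b * c * d)
    lemma₂ = ℕ-Solver.solve-∀

  -- A common divisor of d and f divides e b, and one of e and f divides d c, which gives the new
  -- coprimalities. Since f is known only through f · a, the new conserved identity is proved after
  -- multiplication by a², where f occurs only in that product.
  shift : ∀ {a b c d e f} → Window a b c d e → f * a ≡ e * b + d * c → Window b c d e f
  shift {a} {b} {c} {d} {e} {f} win eq = record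
    { a≢0 = b≢0 ; b≢0 = c≢0 ; c≢0 = d≢0 ; d≢0 = e≢0 ; e≢0 = f≢0
    ; a⊥b = b⊥c ; a⊥c = b⊥d ; b⊥c = c⊥d ; b⊥d = c⊥e ; c⊥d = d⊥e ; c⊥e = d⊥f ; d⊥e = e⊥f
    ; conserved = ℕ.*-cancelˡ-≡ _ _ (a * a) {{ℕ.m*n≢0 a a {{a≢0}} {{a≢0}}}} conserved′
    }
    where
    open Window win
    open ≡-Reasoning
    f≢0 : NonZero f
    f≢0 = ℕ.≢-nonZero λ f≡0 → ℕ.≢-nonZero⁻¹ (e * b) {{ℕ.m*n≢0 e b {{e≢0}} {{b≢0}}}}
      (ℕ.m+n≡0⇒m≡0 (e * b) (trans (sym eq) (cong (_* a) f≡0)))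
    d⊥f : Coprime d f
    d⊥f {g} (g∣d , g∣f) = coprime-product d⊥e (Coprimality.sym b⊥d) (g∣d ,
      ℕᵈ.∣m+n∣m⇒∣n (subst (g ∣_) (trans eq (ℕ.+-comm (e * b) (d * c))) (ℕᵈ.∣m⇒∣m*n a g∣f)) (ℕᵈ.∣m⇒∣m*n c g∣d))
    e⊥f : Coprime e f
    e⊥f {g} (g∣e , g∣f) = coprime-product (Coprimality.sym d⊥e) (Coprimality.sym c⊥e) (g∣e ,
      ℕᵈ.∣m+n∣m⇒∣n (subst (g ∣_) eq (ℕᵈ.∣m⇒∣m*n a g∣f)) (ℕᵈ.∣m⇒∣m*n b g∣e))
    lemma₁ : ∀ a b c d e f → a * a * ((b * (e * e) + c * c * f) * (b * f + d * d) + d * d * (c * d * e)) ≡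
      (a * b * (e * e) + c * c * (f * a)) * (b * (f * a) + a * (d * d)) + a * a * (d * d * (c * d * e))
    lemma₁ = ℕ-Solver.solve-∀
    lemma₂ : ∀ a b c d e → (a * b * (e * e) + c * c * (e * b + d * c)) * (b * (e * b + d * c) + a * (d * d)) + a * a * (d * d * (c * d * e)) ≡
      (e * b + d * c) * ((a * (d * d) + b * b * e) * (a * e + c * c) + c * c * (b * c * d))
    lemma₂ = ℕ-Solver.solve-∀
    lemma₃ : ∀ a b c d e → (e * b + d * c) * (5 * (a * e) * (b * c * d)) ≡ a * (5 * (b * (e * b + d * c)) * (c * d * e))
    lemma₃ = ℕ-Solver.solve-∀
    lemma₄ : ∀ a b c d e f → a * (5 * (b * (f * a)) * (c * d * e)) ≡ a * a * (5 * (b * f) * (c * d * e))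
    lemma₄ = ℕ-Solver.solve-∀
    conserved′ : a * a * ((b * (e * e) + c * c * f) * (b * f + d * d) + d * d * (c * d * e)) ≡ a * a * (5 * (b * f) * (c * d * e))
    conserved′ = begin
      a * a * ((b * (e * e) + c * c * f) * (b * f + d * d) + d * d * (c * d * e))
        ≡⟨ lemma₁ a b c d e f ⟩
      (a * b * (e * e) + c * c * (f * a)) * (b * (f * a) + a * (d * d)) + a * a * (d * d * (c * d * e))
        ≡⟨ cong (λ n → (a * b * (e * e) + c * c * n) * (b * n + a * (d * d)) + a * a * (d * d * (c * d * e))) eq ⟩
      (a * b * (e * e) + c * c * (e * b + d * c)) * (b * (e * b + d * c) + a * (d * d)) + a * a * (d * d * (c * d * e))
        ≡⟨ lemma₂ a b c d e ⟩
      (e * b + d * c) * ((a * (d * d) + b * b * e) * (a * e + c * c) + c * c * (b * c * d))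
        ≡⟨ cong ((e * b + d * c) *_) conserved ⟩
      (e * b + d * c) * (5 * (a * e) * (b * c * d))
        ≡⟨ lemma₃ a b c d e ⟩
      a * (5 * (b * (e * b + d * c)) * (c * d * e))
        ≡⟨ cong (λ n → a * (5 * (b * n) * (c * d * e))) eq ⟨
      a * (5 * (b * (f * a)) * (c * d * e))
        ≡⟨ lemma₄ a b c d e f ⟩
      a * a * (5 * (b * f) * (c * d * e)) ∎

  divℕ-exact : ∀ n a → NonZero a → a ∣ n → divℕ n a * a ≡ n
  divℕ-exact n (suc a) _ a∣n = m/n*n≡m a∣n

  -- Proved together with `recurrence`: the window at k makes the rounding division `divℕ` exact,
  -- and the resulting recurrence moves the window to k + 1.
  window : ∀ k → Window (somos5 k) (somos5 (1 + k)) (somos5 (2 + k)) (somos5 (3 + k)) (somos5 (4 + k))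
  recurrence : ∀ k → somos5 (5 + k) * somos5 k ≡ somos5 (4 + k) * somos5 (1 + k) + somos5 (3 + k) * somos5 (2 + k)

  window zero = record
    { a≢0 = _ ; b≢0 = _ ; c≢0 = _ ; d≢0 = _ ; e≢0 = _
    ; a⊥b = 1⊥1 ; a⊥c = 1⊥1 ; b⊥c = 1⊥1 ; b⊥d = 1⊥1 ; c⊥d = 1⊥1 ; c⊥e = 1⊥1 ; d⊥e = 1⊥1 ; conserved = refl }
    where
    1⊥1 : Coprime 1 1
    1⊥1 (g∣1 , _) = ℕᵈ.∣1⇒≡1 g∣1
  window (suc k) = shift (window k) (recurrence k)

  recurrence k = divℕ-exact _ (somos5 k) (Window.a≢0 (window k)) (exact (window k))

-- Bounded search for a least witness.

module Search where
  open import Data.Nat.Base using (_<_)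

  least : ∀ {P : ℕ → Set} → (∀ n → Dec (P n)) → ∀ n →
    (∃ λ m → m < n × P m × (∀ i → i < m → ¬ P i)) ⊎ (∀ i → i < n → ¬ P i)
  least P? zero = inj₂ (λ _ ())
  least {P} P? (suc n) with least P? n
  ... | inj₁ (m , m<n , Pm , min) = inj₁ (m , ℕ.m<n⇒m<1+n m<n , Pm , min)
  ... | inj₂ none with P? n
  ...   | yes Pn = inj₁ (n , ℕ.≤-refl , Pn , none)
  ...   | no ¬Pn = inj₂ none′
    where
    none′ : ∀ i → i < suc n → ¬ P i
    none′ i i<1+n with ℕ.m≤n⇒m<n∨m≡n (ℕ.s≤s⁻¹ i<1+n)
    ... | inj₁ i<n  = none i i<n
    ... | inj₂ refl = ¬Pn

-- The orbit of T in terms of Somos-5 ratios.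

module SomosOrbit {p : ℕ} (prime : Prime p) (p≢2 : p ≢ 2) (p≢3 : p ≢ 3) where
  open import Data.Integer.Base using (_+_; _*_; _-_; -_)
  open Curves prime p≢2 p≢3
  open Search using (least)

  T : Point
  T = reduce p (+ 0) (+ 0)

  record Level (w v : ℤ) : Set where
    constructor level
    field relation : w * v * (w + v) + w + v + + 1 ≋ + 5 * (w * v)

  -- Vieta's sum formula: for fixed nonzero v, `Level` is quadratic in its first variable, with
  -- roots w and u.
  record Next (w v u : ℤ) : Set where
    constructor next
    field relation : v * (w + u) + v * v + + 1 ≋ + 5 * v

  -- mP + T in the coordinates w = a d / (b c), v = b e / (c d), where a, b, c, d, e
  -- are the Somos-5 terms of index m, …, m + 4: the line joining it to P has slope 2 − v.
  Ψ : ℤ → ℤ → Point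
  Ψ w v = reduce p (+ 1 - w * v) (+ 3 * (w * v) - w - w * w * v - + 1)

  τ-Ψ : ∀ {w v u} → Level w v → Next w v u → τ (Ψ w v) ≡ Ψ v u
  τ-Ψ {w} {v} {u} (level L) (next N) = trans (cong τ (reduce-cong (≋-reflexive (lemma₁ w v)) (lin₁ (- + 1) L (lemma₂ w v))))
    (trans (τ-generic {t} {l} t≉0 chord′)
      (reduce-cong (lin₁ (+ 1) N (lemma₅ w v u)) (lin₁ (v - + 3) N (lemma₆ w v u))))
    where
    t : ℤ
    t = - + 1 - w * v
    l : ℤ
    l = + 2 - v
    lemma₁ : ∀ w v → + 1 - w * v ≡ + 2 + (- + 1 - w * v)
    lemma₁ = solve-∀
    lemma₂ : ∀ w v → + 3 * (w * v) - w - w * w * v - + 1 - (+ 2 + (+ 2 - v) * (- + 1 - w * v)) ≡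
      - + 1 * (w * v * (w + v) + w + v + + 1 - + 5 * (w * v))
    lemma₂ = solve-∀
    lemma₃ : ∀ w v → + 6 - + 0 ≡
      + 1 * (w * v * (w + v) + w + v + + 1 - + 5 * (w * v)) + (w + v - + 5) * (- + 1 - w * v - + 0)
    lemma₃ = solve-∀
    -- If w v = -1, then `Level` collapses to 1 = -5; hence `Ψ` never reaches abscissa 2.
    t≉0 : t ≉ + 0
    t≉0 e = 6≉0 (lin₂ (+ 1) L (w + v - + 5) e (lemma₃ w v))
    lemma₄ : ∀ w v → (- + 1 - w * v) * ((+ 2 - v) * (+ 2 - v) + (+ 2 - v) - + 7 - (- + 1 - w * v)) -
      (+ 12 - + 6 * (+ 2 - v)) ≡ - v * (w * v * (w + v) + w + v + + 1 - + 5 * (w * v))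
    lemma₄ = solve-∀
    chord′ : Chord t l
    chord′ = vieta (lin₁ (- v) L (lemma₄ w v))
    lemma₅ : ∀ w v u → + 2 + ((+ 2 - v) * (+ 2 - v) + (+ 2 - v) - + 7 - (- + 1 - w * v)) - (+ 1 - v * u) ≡
      + 1 * (v * (w + u) + v * v + + 1 - + 5 * v)
    lemma₅ = solve-∀
    lemma₆ : ∀ w v u → - + 4 - (+ 2 - v + + 1) * ((+ 2 - v) * (+ 2 - v) + (+ 2 - v) - + 7 - (- + 1 - w * v)) -
      (+ 3 * (v * u) - v - v * v * u - + 1) ≡ (v - + 3) * (v * (w + u) + v * v + + 1 - + 5 * v)
    lemma₆ = solve-∀

  -- The recurrence supplies the product (v + 1)/v of the two roots of the quadratic; together with
  -- the root w this determines their sum.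
  next-relation : ∀ {w v u} → w ≉ + 0 → Level w v → w * v * u ≋ v + + 1 → Next w v u
  next-relation {w} {v} {u} w≉0 (level L) e = next (cancel {c = w} w≉0 (lin₂ (+ 1) L (+ 1) e (lemma w v u)))
    where
    lemma : ∀ w v u → w * (v * (w + u) + v * v + + 1) - w * (+ 5 * v) ≡
      + 1 * (w * v * (w + v) + w + v + + 1 - + 5 * (w * v)) + + 1 * (w * v * u - (v + + 1))
    lemma = solve-∀

  next-level : ∀ {w v u} → Next w v u → w * v * u ≋ v + + 1 → Level v u
  next-level {w} {v} {u} (next N) e = level (lin₂ u N (- + 1) e (lemma w v u))
    where
    lemma : ∀ w v u → v * u * (v + u) + v + u + + 1 - + 5 * (v * u) ≡
      u * (v * (w + u) + v * v + + 1 - + 5 * v) + - + 1 * (w * v * u - (v + + 1))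
    lemma = solve-∀

  -- The product of the three ratios telescopes to a f / (c d), and the Somos recurrence turns this
  -- into b e / (c d) + 1.
  ratio-recurrence : ∀ {a b c d e f w v u} → b ≉ + 0 → c ≉ + 0 → d ≉ + 0 → e ≉ + 0 →
    w * (b * c) ≋ a * d → v * (c * d) ≋ b * e → u * (d * e) ≋ c * f → f * a ≋ e * b + d * c →
    w * v * u ≋ v + + 1
  ratio-recurrence {a} {b} {c} {d} {e} {f} {w} {v} {u} b≉0 c≉0 d≉0 e≉0 hw hv hu hf =
    cancel {c = (b * c) * ((c * d) * (d * e))} (nonzero (nonzero b≉0 c≉0) (nonzero (nonzero c≉0 d≉0) (nonzero d≉0 e≉0)))
      (lin₄ (v * (c * d) * (u * (d * e))) hw (a * d * (u * (d * e)) - b * c * (d * e)) hv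
            (a * d * (b * e)) hu (b * c * (d * e)) hf (lemma a b c d e f w v u))
    where
    lemma : ∀ a b c d e f w v u →
      (b * c) * ((c * d) * (d * e)) * (w * v * u) - (b * c) * ((c * d) * (d * e)) * (v + + 1) ≡
      v * (c * d) * (u * (d * e)) * (w * (b * c) - a * d) +
      (a * d * (u * (d * e)) - b * c * (d * e)) * (v * (c * d) - b * e) +
      a * d * (b * e) * (u * (d * e) - c * f) + b * c * (d * e) * (f * a - (e * b + d * c))
    lemma = solve-∀

  τ^ : ℕ → Point → Point
  τ^ zero    X = X
  τ^ (suc k) X = τ (τ^ k X)

  s : ℕ → ℤ
  s k = + somos5 k

  abstract
    s-recurrence : ∀ k → s (5 ℕ.+ k) * s k ≋ s (4 ℕ.+ k) * s (1 ℕ.+ k) + s (3 ℕ.+ k) * s (2 ℕ.+ k)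
    s-recurrence k = ≋-reflexive (trans (sym (ℤ.pos-* (somos5 (5 ℕ.+ k)) (somos5 k)))
      (trans (cong +_ (SomosIntegrality.recurrence k))
        (cong₂ _+_ (ℤ.pos-* (somos5 (4 ℕ.+ k)) (somos5 (1 ℕ.+ k))) (ℤ.pos-* (somos5 (3 ℕ.+ k)) (somos5 (2 ℕ.+ k))))))

  record State (k : ℕ) : Set where
    field
      w v : ℤ
      w-ratio : w * (s (1 ℕ.+ k) * s (2 ℕ.+ k)) ≋ s k * s (3 ℕ.+ k)
      v-ratio : v * (s (2 ℕ.+ k) * s (3 ℕ.+ k)) ≋ s (1 ℕ.+ k) * s (4 ℕ.+ k)
      w,v     : Level w v
      orbit   : τ^ k T ≡ Ψ w v

  unit-ratio : ∀ {w b c a d} → a ≉ + 0 → d ≉ + 0 → w * (b * c) ≋ a * d → w ≉ + 0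
  unit-ratio {w} {b} {c} {a} {d} a≉0 d≉0 h e = nonzero a≉0 d≉0 (lin₂ (- + 1) h (b * c) e (lemma w b c a d))
    where
    lemma : ∀ w b c a d → a * d - + 0 ≡ - + 1 * (w * (b * c) - a * d) + b * c * (w - + 0)
    lemma = solve-∀

  state : ∀ k → (∀ i → i ℕ.< 5 ℕ.+ k → s i ≉ + 0) → State k
  state zero nz = record
    -- The initial terms are all 1, and Ψ 1 1 = (0, 0) = T.
    { w = + 1 ; v = + 1 ; w-ratio = ≋-refl ; v-ratio = ≋-refl ; w,v = level ≋-refl ; orbit = refl }
  state (suc k) nz = go (state k (λ i i< → nz i (ℕ.m<n⇒m<1+n i<)))
    (quotient (nonzero (nz (3 ℕ.+ k) (lt 3 2)) (nz (4 ℕ.+ k) (lt 4 1))) (s (2 ℕ.+ k) * s (5 ℕ.+ k)))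
    where
    lt : ∀ i j → i ℕ.+ k ℕ.< suc j ℕ.+ (i ℕ.+ k)
    lt i j = s≤s (ℕ.m≤n+m (i ℕ.+ k) j)
    go : State k → (∃ λ u → u * (s (3 ℕ.+ k) * s (4 ℕ.+ k)) ≋ s (2 ℕ.+ k) * s (5 ℕ.+ k)) → State (suc k)
    go st (u , u-ratio) = record
      { w = v ; v = u ; w-ratio = v-ratio ; v-ratio = u-ratio
      ; w,v = next-level R wvu ; orbit = trans (cong τ orbit) (τ-Ψ w,v R) }
      where
      open State st
      wvu : w * v * u ≋ v + + 1
      wvu = ratio-recurrence {s k} {s (1 ℕ.+ k)} {s (2 ℕ.+ k)} {s (3 ℕ.+ k)} {s (4 ℕ.+ k)} {s (5 ℕ.+ k)} {w} {v} {u}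
        (nz (1 ℕ.+ k) (lt 1 4)) (nz (2 ℕ.+ k) (lt 2 3)) (nz (3 ℕ.+ k) (lt 3 2)) (nz (4 ℕ.+ k) (lt 4 1))
        w-ratio v-ratio u-ratio (s-recurrence k)
      R : Next w v u
      R = next-relation (unit-ratio {w} {s (1 ℕ.+ k)} {s (2 ℕ.+ k)} {s k} {s (3 ℕ.+ k)} (nz k (lt 0 5)) (nz (3 ℕ.+ k) (lt 3 2)) w-ratio) w,v wvu

  s≉0 : ∀ i → ¬ p ℕᵈ.∣ somos5 i → s i ≉ + 0
  s≉0 i ∤ e = ∤ (≋0⇒∣ e)

  -- If the first 5 + j terms were all units, the j-th point would be given by `Ψ` and so be affine.
  orbit-meets-O⇒∣ : ∀ j → τ^ j T ≡ O → DividesSomos5 p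
  orbit-meets-O⇒∣ j τ^j≡O with least (λ i → p ℕᵈ.∣? somos5 i) (5 ℕ.+ j)
  ... | inj₁ (i , _ , p∣ , _) = i , p∣
  ... | inj₂ none = contradiction (trans (sym τ^j≡O) (State.orbit (state j (λ i i< → s≉0 i (none i i<))))) (λ ())

  -- When the next term vanishes, the recurrence gives b e = -c d, so v = -1; then `Level` becomes
  -- w² = 7w and w = 7 because w is a unit. The point Ψ 7 (-1) = (8, 20) is -3P, and three further
  -- translations lead through -2P and -P to O.
  first-zero : ∀ k → (∀ i → i ℕ.< 5 ℕ.+ k → s i ≉ + 0) → s (5 ℕ.+ k) ≋ + 0 → τ^ (3 ℕ.+ k) T ≡ O
  first-zero k nz z = trans (cong (τ ∘ τ ∘ τ) (trans orbit (reduce-cong (lin₂ (- + 7) v≋-1 (- v) w≋7 (lemma₃ w v))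
      (lin₂ (+ 3 * w - w * w) v≋-1 (w + + 3) w≋7 (lemma₄ w v)))))
    (trans (cong (τ ∘ τ) (τ-Ψ {+ 7} { - + 1} {+ 0} (level ≋-refl) (next ≋-refl)))
      (trans (cong τ (τ-generic { - + 1} {+ 2} (λ h → 1≉0 (lin₁ (- + 1) h refl)) (vieta ≋-refl))) τ--P))
    where
    open State (state k nz)
    nz₂ : s (2 ℕ.+ k) ≉ + 0
    nz₂ = nz (2 ℕ.+ k) (s≤s (ℕ.m≤n+m _ 2))
    nz₃ : s (3 ℕ.+ k) ≉ + 0
    nz₃ = nz (3 ℕ.+ k) (s≤s (ℕ.m≤n+m _ 1))
    lemma₁ : ∀ a b c d e f v → (c * d) * v - (c * d) * - + 1 ≡
      + 1 * (v * (c * d) - b * e) + - + 1 * (f * a - (e * b + d * c)) + a * (f - + 0)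
    lemma₁ = solve-∀
    v≋-1 : v ≋ - + 1
    v≋-1 = cancel {c = s (2 ℕ.+ k) * s (3 ℕ.+ k)} (nonzero nz₂ nz₃)
      (lin₃ (+ 1) v-ratio (- + 1) (s-recurrence k) (s k) z
        (lemma₁ (s k) (s (1 ℕ.+ k)) (s (2 ℕ.+ k)) (s (3 ℕ.+ k)) (s (4 ℕ.+ k)) (s (5 ℕ.+ k)) v))
    lemma₂ : ∀ w v → w * w - w * + 7 ≡
      - + 1 * (w * v * (w + v) + w + v + + 1 - + 5 * (w * v)) +
      (w * w + w * (v - + 1) + + 1 - + 5 * w) * (v - - + 1)
    lemma₂ = solve-∀
    w≋7 : w ≋ + 7
    w≋7 = cancel {c = w} (unit-ratio {w} {s (1 ℕ.+ k)} {s (2 ℕ.+ k)} {s k} {s (3 ℕ.+ k)} (nz k (s≤s (ℕ.m≤n+m k 4))) nz₃ w-ratio)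
      (lin₂ (- + 1) (Level.relation w,v) (w * w + w * (v - + 1) + + 1 - + 5 * w) v≋-1 (lemma₂ w v))
    lemma₃ : ∀ w v → + 1 - w * v - + 8 ≡ - + 7 * (v - - + 1) + - v * (w - + 7)
    lemma₃ = solve-∀
    lemma₄ : ∀ w v → + 3 * (w * v) - w - w * w * v - + 1 - + 20 ≡
      (+ 3 * w - w * w) * (v - - + 1) + (w + + 3) * (w - + 7)
    lemma₄ = solve-∀

  ∣⇒orbit-meets-O : DividesSomos5 p → ∃ λ j → τ^ j T ≡ O
  ∣⇒orbit-meets-O (m , p∣m) with least (λ i → p ℕᵈ.∣? somos5 i) (suc m)
  ... | inj₂ none = contradiction p∣m (none m ℕ.≤-refl)
  ... | inj₁ (m₀ , _ , p∣m₀ , min) = go m₀ p∣m₀ min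
    where
    p∤1 : ¬ p ℕᵈ.∣ 1
    p∤1 d = 1≉0 (∣⇒≋0 d)
    go : ∀ n → p ℕᵈ.∣ somos5 n → (∀ i → i ℕ.< n → ¬ p ℕᵈ.∣ somos5 i) → ∃ λ j → τ^ j T ≡ O
    go 0 d _ = contradiction d p∤1
    go 1 d _ = contradiction d p∤1
    go 2 d _ = contradiction d p∤1
    go 3 d _ = contradiction d p∤1
    go 4 d _ = contradiction d p∤1
    go (suc (suc (suc (suc (suc k))))) d min =
      3 ℕ.+ k , first-zero k (λ i i< → s≉0 i (min i i<)) (∣⇒≋0 {s (5 ℕ.+ k)} d)

-- The orders of P and R.

module Orders {p : ℕ} (prime : Prime p) (p≢2 : p ≢ 2) (p≢3 : p ≢ 3) where
  open import Data.Nat.Base using (_+_; _*_; _<_; _≤_)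
  open Curves prime p≢2 p≢3
  open Isogeny prime p≢2 p≢3 using (Φ; φ-O; φ-aff⁻¹; φ-O⁻¹; φ-kernel; Φ-step)
  open SomosOrbit prime p≢2 p≢3 using (T; τ^; orbit-meets-O⇒∣; ∣⇒orbit-meets-O)
  open Search using (least)

  _≟_ : (X Y : Point) → Dec (X ≡ Y)
  O       ≟ O         = yes refl
  O       ≟ aff _ _   = no λ ()
  aff _ _ ≟ O         = no λ ()
  aff x y ≟ aff x′ y′ = map′ (λ (e , e′) → cong₂ aff e e′) (λ { refl → refl , refl }) (x ℤ.≟ x′ ×-dec y ℤ.≟ y′)

  smul≡τ^ : ∀ k → smul Ecurve p k (Pmod p) ≡ τ^ k O
  smul≡τ^ zero    = refl
  smul≡τ^ (suc k) = trans (sym (τ≡add _)) (cong τ (smul≡τ^ k))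

  on-τ^ : ∀ k {X} → On X → On (τ^ k X)
  on-τ^ zero    o = o
  on-τ^ (suc k) o = on-τ (on-τ^ k o)

  Φ-smul : ∀ k → Φ (τ^ k O) (smul E'curve p k (Rmod p))
  Φ-smul zero    = φ-O refl refl
  Φ-smul (suc k) = subst (Φ (τ^ (suc k) O)) (τ′≡add _) (Φ-step (on-τ^ k on-O) (Φ-smul k))

  τ^-+ : ∀ i j X → τ^ (i + j) X ≡ τ^ i (τ^ j X)
  τ^-+ zero    j X = refl
  τ^-+ (suc i) j X = cong τ (τ^-+ i j X)

  τ^-τ : ∀ k X → τ^ k (τ X) ≡ τ (τ^ k X)
  τ^-τ zero    X = refl
  τ^-τ (suc k) X = cong τ (τ^-τ k X)

  -- The reversed path: each use of `τ-neg-τ` undoes the last translation, on negated points.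
  τ^-neg : ∀ k {X} → On X → τ^ k (neg (τ^ k X)) ≡ neg X
  τ^-neg zero    o = refl
  τ^-neg (suc k) o = trans (sym (τ^-τ k _)) (trans (cong (τ^ k) (τ-neg-τ (on-τ^ k o))) (τ^-neg k o))

  on-T : On T
  on-T = on-aff (curve ≋-refl)

  neg-T : neg T ≡ T
  neg-T = neg-reduce (+ 0) (+ 0)

  O→T⇒T→O : ∀ k → τ^ k O ≡ T → τ^ k T ≡ O
  O→T⇒T→O k e = trans (cong (τ^ k) (sym (trans (cong neg e) neg-T))) (τ^-neg k on-O)

  T→O⇒O→T : ∀ k → τ^ k T ≡ O → τ^ k O ≡ T
  T→O⇒O→T k e = trans (cong (τ^ k) (sym (cong neg e))) (trans (τ^-neg k on-T) neg-T)

  τ^-injective : ∀ k {X Y} → On X → On Y → τ^ k X ≡ τ^ k Y → X ≡ Y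
  τ^-injective zero    oX oY e = e
  τ^-injective (suc k) oX oY e = τ^-injective k oX oY (τ-injective (on-τ^ k oX) (on-τ^ k oY) e)

  residue : ∀ a → ∃ λ (i : Fin p) → red p a ≡ + toℕ i
  residue a = go p {{prime⇒nonZero prime}}
    where
    go : ∀ q → .{{NonZero q}} → ∃ λ (i : Fin q) → red q a ≡ + toℕ i
    go (suc q) = Fin.fromℕ< (n%ℕd<d a (suc q)) , cong +_ (sym (Fin.toℕ-fromℕ< (n%ℕd<d a (suc q))))

  code : ∀ {X} → On X → Fin (suc (p * p))
  code on-O               = zero
  code (on-aff {x} {y} _) = suc (Fin.combine (proj₁ (residue x)) (proj₁ (residue y)))

  residue-injective : ∀ {x y} → proj₁ (residue x) ≡ proj₁ (residue y) → red p x ≡ red p y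
  residue-injective {x} {y} e = trans (proj₂ (residue x)) (trans (cong (λ i → + toℕ i) e) (sym (proj₂ (residue y))))

  code-injective : ∀ {X Y} (oX : On X) (oY : On Y) → code oX ≡ code oY → X ≡ Y
  code-injective on-O on-O e = refl
  code-injective (on-aff {x} {y} _) (on-aff {x′} {y′} _) e
    with Fin.combine-injective (proj₁ (residue x)) (proj₁ (residue y)) (proj₁ (residue x′)) (proj₁ (residue y′)) (Fin.suc-injective e)
  ... | e₁ , e₂ = cong₂ aff (residue-injective {x} {x′} e₁) (residue-injective {y} {y′} e₂)

  abstract
    -- Pigeonhole: p² + 2 iterates receive p² + 1 codes, one for O and p² for pairs of residues.
    -- Injectivity then strips the common initial steps, so the return is to O itself.
    recurrent : ∃ λ k → τ^ (suc k) O ≡ O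
    recurrent with Fin.pigeonhole (ℕ.n<1+n (suc (p * p))) (λ i → code (on-τ^ (toℕ i) on-O))
    ... | i , j , i<j , e with ℕ.m≤n⇒∃[o]m+o≡n i<j
    ...   | k , i+k≡j = k , sym (τ^-injective (toℕ i) on-O (on-τ^ (suc k) on-O) (trans
              (code-injective (on-τ^ (toℕ i) on-O) (on-τ^ (toℕ j) on-O) e)
              (trans (cong (λ n → τ^ n O) (trans (sym i+k≡j) (sym (ℕ.+-suc (toℕ i) k))))
                (τ^-+ (toℕ i) (suc k) O))))

  record Order (n : ℕ) : Set where
    field
      positive : 1 ≤ n
      period   : τ^ n O ≡ O
      minimal  : ∀ k → 1 ≤ k → k < n → τ^ k O ≢ O

  abstract
    order : ∃ Order
    order = go (least (λ k → τ^ (suc k) O ≟ O) (suc (proj₁ recurrent)))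
      where
      go : (∃ λ m → m < suc (proj₁ recurrent) × τ^ (suc m) O ≡ O × (∀ i → i < m → τ^ (suc i) O ≢ O)) ⊎
           (∀ i → i < suc (proj₁ recurrent) → τ^ (suc i) O ≢ O) → ∃ Order
      go (inj₁ (m , _ , e , min)) = suc m , record
        { positive = s≤s z≤n ; period = e ; minimal = λ { (suc k) _ (s≤s k<m) → min k k<m } }
      go (inj₂ none) = contradiction (proj₂ recurrent) (none _ ℕ.≤-refl)

  isOrder : ∀ {n} → Order n → IsOrder Ecurve p (Pmod p) n
  isOrder {n} ord = positive , trans (smul≡τ^ n) period ,
    λ k 1≤k k<n e → minimal k 1≤k k<n (trans (sym (smul≡τ^ k)) e)
    where open Order ord

  φT≡O : ∀ {Y} → Φ T Y → Y ≡ O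
  φT≡O f with φ-aff⁻¹ f
  ... | inj₁ (_ , e)     = e
  ... | inj₂ (r , h , _) = contradiction (≋-sym h) 1≉0

  -- Covers both cases of the theorem: m is either the first time the multiples of P hit T, or the
  -- full order when they never do.
  isOrder′ : ∀ {n m} → Order n → 1 ≤ m → m ≤ n → τ^ m O ≡ O ⊎ τ^ m O ≡ T →
    (∀ k → k < m → τ^ k O ≢ T) → IsOrder E'curve p (Rmod p) m
  isOrder′ {n} {m} ord 1≤m m≤n end avoids = 1≤m , kernel end , minimal′
    where
    open Order ord
    kernel : τ^ m O ≡ O ⊎ τ^ m O ≡ T → smul E'curve p m (Rmod p) ≡ O
    kernel (inj₁ e) = φ-O⁻¹ (subst (λ X → Φ X (smul E'curve p m (Rmod p))) e (Φ-smul m))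
    kernel (inj₂ e) = φT≡O (subst (λ X → Φ X (smul E'curve p m (Rmod p))) e (Φ-smul m))
    minimal′ : ∀ k → 1 ≤ k → k < m → smul E'curve p k (Rmod p) ≢ O
    minimal′ k 1≤k k<m e with φ-kernel (subst (Φ (τ^ k O)) e (Φ-smul k))
    ... | inj₁ e′ = minimal k 1≤k (ℕ.<-≤-trans k<m m≤n) e′
    ... | inj₂ e′ = avoids k k<m e′

  -- Two steps of length m lead from O to T and back, so 2m is a period and n ≤ 2m. If n < 2m, then
  -- 2m - n would be a positive period, smaller than n because m < n.
  order≡2* : ∀ {n m} → Order n → m < n → τ^ m O ≡ T → n ≡ 2 * m
  order≡2* {n} {m} ord m<n e = ℕ.≤-antisym (ℕ.≮⇒≥ n≯2m) (ℕ.≮⇒≥ n≮2m)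
    where
    open Order ord
    2m≡m+m : 2 * m ≡ m + m
    2m≡m+m = cong (λ k → m + k) (ℕ.+-identityʳ m)
    period′ : τ^ (2 * m) O ≡ O
    period′ = trans (cong (λ k → τ^ k O) 2m≡m+m) (trans (τ^-+ m m O) (trans (cong (τ^ m) e) (O→T⇒T→O m e)))
    1≤m : 1 ≤ m
    1≤m = ℕ.n≢0⇒n>0 λ { refl → contradiction e λ () }
    n≯2m : ¬ 2 * m < n
    n≯2m 2m<n = minimal (2 * m) (ℕ.≤-trans 1≤m (ℕ.m≤m+n m _)) 2m<n period′
    n≮2m : ¬ n < 2 * m
    n≮2m n<2m = minimal (2 * m ∸ n) (ℕ.m<n⇒0<n∸m n<2m)
      (ℕ.+-cancelʳ-< n (2 * m ∸ n) n (subst (_< n + n) (sym (ℕ.m∸n+n≡m (ℕ.<⇒≤ n<2m)))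
        (subst (_< n + n) (sym 2m≡m+m) (ℕ.+-mono-< m<n m<n))))
      (trans (cong (τ^ (2 * m ∸ n)) (sym period)) (trans (sym (τ^-+ (2 * m ∸ n) n O))
        (trans (cong (λ k → τ^ k O) (ℕ.m∸n+n≡m (ℕ.<⇒≤ n<2m))) period′)))

  τ^-* : ∀ {n} → τ^ n O ≡ O → ∀ q → τ^ (q * n) O ≡ O
  τ^-* e zero = refl
  τ^-* {n} e (suc q) = trans (τ^-+ n (q * n) O) (trans (cong (τ^ n) (τ^-* e q)) e)

  -- Reducing j modulo n makes a search below n decide whether T is a multiple of P at all.
  visit-before-period : ∀ {n} j → 1 ≤ n → τ^ n O ≡ O → ∃ λ k → k < n × τ^ k O ≡ τ^ j O
  visit-before-period {suc n} j _ e = j % suc n , m%n<n j (suc n) ,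
    sym (trans (cong (λ k → τ^ k O) (m≡m%n+[m/n]*n j (suc n)))
      (trans (τ^-+ (j % suc n) (j / suc n * suc n) O) (cong (τ^ (j % suc n)) (τ^-* e (j / suc n)))))

  orders : Σ ℕ λ n → Σ ℕ λ m → IsOrder Ecurve p (Pmod p) n × IsOrder E'curve p (Rmod p) m ×
    (DividesSomos5 p → n ≡ 2 * m) × (¬ DividesSomos5 p → n ≡ m)
  orders = go order
    where
    go : ∃ Order → Σ ℕ λ n → Σ ℕ λ m → IsOrder Ecurve p (Pmod p) n × IsOrder E'curve p (Rmod p) m ×
      (DividesSomos5 p → n ≡ 2 * m) × (¬ DividesSomos5 p → n ≡ m)
    -- If T is found, the path from T back to O yields a term divisible by p. If not, such a term
    -- would make T equal to some jP, hence to some kP with k < n.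
    go (n , ord) with least (λ k → τ^ k O ≟ T) n
    ... | inj₁ (m , m<n , e , avoids) = n , m , isOrder ord ,
          isOrder′ ord (ℕ.n≢0⇒n>0 λ { refl → contradiction e λ () }) (ℕ.<⇒≤ m<n) (inj₂ e) avoids ,
          (λ _ → order≡2* ord m<n e) ,
          (λ ∤ → contradiction (orbit-meets-O⇒∣ m (O→T⇒T→O m e)) ∤)
    ... | inj₂ avoids = n , n , isOrder ord , isOrder′ ord positive ℕ.≤-refl (inj₁ period) avoids ,
          (λ d → ⊥-elim (unreachable (∣⇒orbit-meets-O d))) , (λ _ → refl)
      where
      open Order ord
      unreachable : ¬ (∃ λ j → τ^ j T ≡ O)
      unreachable (j , e) with visit-before-period j positive period
      ... | k , k<n , e′ = avoids k k<n (trans e′ (T→O⇒O→T j e))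

open import Data.Nat using (_*_)

theorem3p2 : (p : ℕ) → Prime p → p ≢ 2 → p ≢ 3 → p ≢ 17 →
    Σ ℕ λ n → Σ ℕ λ m →
    IsOrder Ecurve p (Pmod p) n × IsOrder E'curve p (Rmod p) m ×
    (DividesSomos5 p → n ≡ 2 * m) × (¬ DividesSomos5 p → n ≡ m)
theorem3p2 p p-prime p≢2 p≢3 _ = Orders.orders p-prime p≢2 p≢3
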